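{- Let $m,k$ be integers such that $k$ divides $m$ and $\gcd(2^m-1,2^k+1)=1$, let $e=2^m-2^k-2$ and $d$ the inverse of $e$ modulo $2^m-1$, and let $\pi(i)=\gamma_i$ be a bijection from $\mathbb{Z}_{2^k}$ to $\mathbb{F}_{2^k}$. Define $f_A,f_B:\mathbb{F}_{2^m}\times\mathbb{F}_{2^m}\to\mathbb{Z}_{2^k}$ by: $f_A(x,y)=i$ if $(x,y)\in\mathcal{A}(\gamma_i)$, and $f_A(0,y)=0$ for all $y\in\mathbb{F}_{2^m}$; $f_B(x,y)=i$ if $(x,y)\in\mathcal{B}(\gamma_i)$, and $f_B(x,0)=0$ for all $x\in\mathbb{F}_{2^m}$. Then $f_A$ and $f_B$ are $\mathbb{Z}_{2^k}$-bent functions.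
   Context: ${\rm Tr}^m_k$ is the relative trace $\mathbb{F}_{2^m}\to\mathbb{F}_{2^k}$, ${\rm Tr}_m$ the absolute trace; powers of nonzero elements have exponents modulo $2^m-1$. For $\gamma\in\mathbb{F}_{2^k}$: $\mathcal{A}(\gamma)=\bigcup_{s\in\mathbb{F}_{2^m}:{\rm Tr}^m_k(s)=\gamma}\{(x,sx^{2^k+1}):x\in\mathbb{F}_{2^m}^*\}$ and $\mathcal{B}(\gamma)=\bigcup_{s\in\mathbb{F}_{2^m}:{\rm Tr}^m_k(s)=\gamma}\{(x^{ -d}s,x):x\in\mathbb{F}_{2^m}^*\}$ (the sets $\mathcal{A}(\gamma)$ together with $\{(0,y)\}$ partition $\mathbb{F}_{2^m}^2$, and likewise the $\mathcal{B}(\gamma)$ together with $\{(x,0)\}$). A function $f:\mathbb{F}_{2^m}\times\mathbb{F}_{2^m}\to\mathbb{Z}_{2^k}$ is $\mathbb{Z}_{2^k}$-bent if $\left|\sum_{x,y\in\mathbb{F}_{2^m}}\zeta^{af(x,y)}(-1)^{{\rm Tr}_m(ux+vy)}\right|=2^m$ for all nonzero $a\in\mathbb{Z}_{2^k}$ and all $u,v\in\mathbb{F}_{2^m}$, with $\zeta$ a complex primitive $2^k$-th root of unity. -}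

module Defs where

open import Level using (0ℓ)
open import Data.Nat as ℕ using (ℕ; zero; suc; _<_; NonZero)
open import Data.Nat.DivMod using (_%_)
open import Data.Nat.Properties using (m^n≢0)
open import Data.Integer as ℤ using (ℤ; +_)
open import Data.Fin using (Fin; toℕ)
open import Data.List using (List; foldr; length)
open import Data.List.Membership.Propositional using (_∈_)
open import Data.List.Relation.Unary.Unique.Propositional using (Unique)
open import Data.Product using (Σ; _×_; ∃)
open import Data.Bool using (if_then_else_)
open import Relation.Nullary using (¬_; Dec; does)
open import Relation.Binary.PropositionalEquality using (_≡_)
open import Algebra.Structures using (IsCommutativeRing)

record GF2^ (m : ℕ) : Set₁ where
  infixl 6 _+_
  infixl 7 _*_
  field
    Carrier : Set
    _+_ _*_ : Carrier → Carrier → Carrier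
    -_      : Carrier → Carrier
    0# 1#   : Carrier
    isCommutativeRing : IsCommutativeRing _≡_ _+_ _*_ -_ 0# 1#
    1≢0     : ¬ (1# ≡ 0#)
    inverse : ∀ x → ¬ (x ≡ 0#) → Σ Carrier λ y → x * y ≡ 1#
    char2   : 1# + 1# ≡ 0#
    _≟_     : (x y : Carrier) → Dec (x ≡ y)
    elems   : List Carrier
    complete : ∀ x → x ∈ elems
    unique  : Unique elems
    size    : length elems ≡ 2 ℕ.^ m

  _^_ : Carrier → ℕ → Carrier
  x ^ zero  = 1#
  x ^ suc n = x * (x ^ n)

  sumF : ℕ → (ℕ → Carrier) → Carrier
  sumF zero    g = 0#
  sumF (suc n) g = g n + sumF n g

  Tr : Carrier → Carrier
  Tr z = sumF m (λ i → z ^ (2 ℕ.^ i))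

  -- relative trace Tr^m_k(z) = Σ_{i<m/k} z^{2^{ik}}, where m = q·k
  relTr : (k q : ℕ) → Carrier → Carrier
  relTr k q z = sumF q (λ i → z ^ (2 ℕ.^ (i ℕ.* k)))

  -- x^{-d} for nonzero x (exponents modulo 2^m - 1):
  -- x^{-1} = x^{2^m - 2}, hence x^{-d} = x^{(2^m-2)·d}
  negPow : Carrier → ℕ → Carrier
  negPow x d = x ^ ((2 ℕ.^ m ℕ.∸ 2) ℕ.* d)

  sign : Carrier → ℤ
  sign z = if does (Tr z ≟ 0#) then + 1 else ℤ.- (+ 1)

  sumℤ : (Carrier → ℤ) → ℤ
  sumℤ g = foldr (λ x acc → g x ℤ.+ acc) (+ 0) elems

  InSubfield : ℕ → Carrier → Set
  InSubfield k γ = γ ^ (2 ℕ.^ k) ≡ γ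

  InA : (k q : ℕ) → Carrier → Carrier → Carrier → Set
  InA k q γ x y = ¬ (x ≡ 0#) × ∃ λ s → relTr k q s ≡ γ × y ≡ s * (x ^ (2 ℕ.^ k ℕ.+ 1))

  InB : (k q d : ℕ) → Carrier → Carrier → Carrier → Set
  InB k q d γ x y = ¬ (y ≡ 0#) × ∃ λ s → relTr k q s ≡ γ × x ≡ negPow y d * s

-- The cyclotomic ring ℤ[ζ], ζ a primitive 2^k-th root of unity (k ≥ 1).
-- An element Σ_{j<2^k} c_j ζ^j is represented by its coefficient
-- function c : ℕ → ℤ (only j < 2^k matter).  Since ζ^{2^{k-1}} = -1 and
-- 1, ζ, …, ζ^{2^{k-1}-1} is a ℤ-basis of ℤ[ζ] (Φ_{2^k} = X^{2^{k-1}}+1 is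
-- irreducible), Σ c_j ζ^j = Σ c'_j ζ^j holds in ℂ iff for all t < 2^{k-1}
-- c_t - c_{t+2^{k-1}} = c'_t - c'_{t+2^{k-1}}.

Coeffs : Set
Coeffs = ℕ → ℤ

modPow2 : (k : ℕ) → ℕ → ℕ
modPow2 k j = _%_ j (2 ℕ.^ k) {{m^n≢0 2 k}}

CycloEq : (k : ℕ) → Coeffs → Coeffs → Set
CycloEq k c c' = ∀ t → t < H → c t ℤ.- c (t ℕ.+ H) ≡ c' t ℤ.- c' (t ℕ.+ H)
  where H = 2 ℕ.^ (k ℕ.∸ 1)

sumℕ : ℕ → (ℕ → ℤ) → ℤ
sumℕ zero    g = + 0
sumℕ (suc n) g = g n ℤ.+ sumℕ n g

-- S · conj(S) where S = Σ_{j<2^k} c_j ζ^j and conj(ζ) = ζ^{-1}: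
-- coefficient of ζ^t is Σ_{i<2^k} c_i c_{(i - t) mod 2^k}
normSq : (k : ℕ) → Coeffs → Coeffs
normSq k c t = sumℕ (2 ℕ.^ k) λ i →
  c i ℤ.* c (modPow2 k (i ℕ.+ (2 ℕ.^ k ℕ.∸ modPow2 k t)))

constC : ℤ → Coeffs
constC n zero    = n
constC n (suc _) = + 0

-- ℤ_{2^k}-bentness (k ≥ 1).  For a ∈ ℤ_{2^k}, u, v ∈ F, the sum
--   S = Σ_{x,y} ζ^{a f(x,y)} (-1)^{Tr_m(ux+vy)}
-- has coefficient of ζ^j equal to
--   Σ_{x,y} [a·f(x,y) ≡ j mod 2^k] (-1)^{Tr_m(ux+vy)},
-- and |S| = 2^m  ⇔  S · conj(S) = 4^m.

module _ {m : ℕ} (F : GF2^ m) where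
  open GF2^ F

  walsh : (k : ℕ) → (Carrier → Carrier → Fin (2 ℕ.^ k)) →
          ℕ → Carrier → Carrier → Coeffs
  walsh k f a u v j = sumℤ λ x → sumℤ λ y →
    if does (modPow2 k (a ℕ.* toℕ (f x y)) ℕ.≟ j)
    then sign (u * x + v * y) else + 0

  IsBent : (k : ℕ) → (Carrier → Carrier → Fin (2 ℕ.^ k)) → Set
  IsBent k f = ∀ (a : ℕ) → a < 2 ℕ.^ k → ¬ (a ≡ 0) →
    ∀ u v → CycloEq k (normSq k (walsh k f a u v)) (constC (+ (4 ℕ.^ m)))

{-# OPTIONS --safe #-}
module Submission where

-- Let χ be the additive character (-1)^Tr_m of F and K = F_{2^k}.  The coprimality hypothesis makes m/k odd, so the
-- relative trace tr fixes K pointwise and χ(ws) = χ(w tr s) for w ∈ K.  Along a curve y = s P(x), with P the power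
-- x ↦ x^(2^k+1) or its inverse, f depends only on tr s, and summing over s leaves T(vP(x)) with
-- T(w) = Σ_s G(f) χ(ws).  This vanishes unless w ∈ K, where it is a multiple of Σ_{γ ∈ K} G(γ) χ(wγ).
-- On K the remaining factor in x becomes an additive character w ↦ χ(wb), and orthogonality on K gives
-- Σ_{x,y} G(f(x,y)) χ(ux+vy) = 2^m G(i₀) for every G of total 0, with i₀ depending on u and v only.
-- Applied to G(i) = [ai = j] - [ai = j + 2^(k-1)] this says that the Walsh sum is 2^m ζ^(a i₀).

open import Defs
open import Algebra.Bundles using (CommutativeRing)
open import Algebra.Structures using (IsCommutativeRing)
open import Data.Bool using (if_then_else_; true; false)
open import Data.Empty using (⊥-elim)
open import Data.Fin as Fin using (Fin; toℕ)
import Data.Fin.Properties as Finₚ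
open import Data.Integer as ℤ using (ℤ)
open import Data.Integer.Divisibility using () renaming (_∣_ to _∣ℤ_)
import Data.Integer.Divisibility.Signed as ∣ₛ
import Data.Integer.Properties as ℤₚ
import Algebra.Properties.AbelianGroup ℤₚ.+-0-abelianGroup as ℤGroup
open import Data.Integer.Tactic.RingSolver using (solve-∀)
open import Data.List using (List; []; _∷_; foldr; length; map; filter; allFin; downFrom)
import Data.List.Properties as Listₚ
open import Data.List.Membership.Propositional using (_∈_)
open import Data.List.Membership.Propositional.Properties using (∈-map⁺; ∈-map⁻; ∈-allFin; ∈-filter⁺; ∈-filter⁻; ∈-downFrom⁺; ∈-downFrom⁻)
open import Data.List.Membership.Propositional.Properties.WithK using (unique∧set⇒bag)
open import Data.List.Relation.Binary.BagAndSetEquality using (∼bag⇒↭)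
open import Data.List.Relation.Binary.Permutation.Propositional as Perm using (_↭_; ↭⇒↭ₛ)
import Data.List.Relation.Binary.Permutation.Propositional.Properties as Permₚ
import Data.List.Relation.Binary.Permutation.Setoid.Properties as Permₛ
open import Data.List.Relation.Unary.All as All using (All; []; _∷_)
import Data.List.Relation.Unary.All.Properties as Allₚ
open import Data.List.Relation.Unary.AllPairs using ([]; _∷_)
open import Data.List.Relation.Unary.Any as Any using (here; there)
open import Data.List.Relation.Unary.Unique.Propositional using (Unique)
import Data.List.Relation.Unary.Unique.Propositional.Properties as Uniqueₚ
open import Data.Maybe using (nothing)
open import Data.Nat as ℕ using (ℕ; zero; suc; NonZero)
open import Data.Nat.Divisibility using (_∣_; divides; ∣1⇒≡1; ∣-refl)
open import Data.Nat.DivMod using (_%_; m%n<n; m<n⇒m%n≡m; [m+n]%n≡m%n; [m+kn]%n≡m%n; %-distribˡ-+)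
open import Data.Nat.GCD using (gcd; gcd-greatest)
import Data.Nat.Properties as ℕₚ
import Data.Nat.Tactic.RingSolver as ℕRing
open import Data.Product using (_×_; _,_; proj₁; proj₂; ∃; ∃₂)
open import Data.Sum using (_⊎_; inj₁; inj₂)
open import Data.Unit using (⊤; tt)
open import Function using (_∘_; id; flip; mk⇔)
open import Function.Definitions using (Injective)
open import Relation.Binary.PropositionalEquality
open import Relation.Nullary using (¬_; Dec; yes; no; does; ¬?)
open import Relation.Nullary.Decidable using (dec-true; dec-false)
open import Tactic.RingSolver.Core.AlmostCommutativeRing using (fromCommutativeRing)
import Tactic.RingSolver.NonReflective as Solver

-- Total 0 is the natural condition on `G`: the constant weight 1 has correlation `4^m` or 0, never
-- `2^m`, so no formula of this kind holds for all weights. On the other side, `CycloEq` sees a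
-- coefficient function only through the differences `c j - c (j + H)` with `H = 2^(k-1)`, and for
-- `a` nonzero modulo `2^k` the weights behind these differences are balanced. Integer weights
-- therefore suffice, and no complex number occurs. The exponent `2^k + 1` matters because on `K` it
-- is squaring: a power map that is additive there and that leaves the absolute trace unchanged. On
-- `K` its inverse is the square root, with the same two properties. Since `e` is `-(2^k + 1)`
-- modulo `2^m - 1`, the inverse on all of `F` is the power `-d`; so exchanging the coordinates
-- brings the curves of `InB` into the shape of those of `InA`.

module Arithmetic where

  open import Data.Integer using (+_; _+_; _*_; -_; _-_)

  -- Finite sums of integers and changes of variable.

  +-congˡ : ∀ a {b c} → b ≡ c → a + b ≡ a + c
  +-congˡ a = cong (λ z → a + z)

  interchange : ∀ a b c d → (a + b) + (c + d) ≡ (a + c) + (b + d)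
  interchange = solve-∀

  left-commute : ∀ a b c → a + (b + c) ≡ b + (a + c)
  left-commute = solve-∀

  *-left-commute : ∀ a b c → a * (b * c) ≡ b * (a * c)
  *-left-commute = solve-∀

  sumOver : {A : Set} → List A → (A → ℤ) → ℤ
  sumOver []       f = + 0
  sumOver (x ∷ xs) f = f x + sumOver xs f

  module _ {A : Set} where

    sumOver-cong : ∀ (xs : List A) {f g} → (∀ x → f x ≡ g x) → sumOver xs f ≡ sumOver xs g
    sumOver-cong []       e = refl
    sumOver-cong (x ∷ xs) e = cong₂ _+_ (e x) (sumOver-cong xs e)

    sumOver-+ : ∀ (xs : List A) f g → sumOver xs (λ x → f x + g x) ≡ sumOver xs f + sumOver xs g
    sumOver-+ []       f g = refl
    sumOver-+ (x ∷ xs) f g rewrite sumOver-+ xs f g = interchange (f x) (g x) _ _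

    sumOver-*ˡ : ∀ (xs : List A) c f → sumOver xs (λ x → c * f x) ≡ c * sumOver xs f
    sumOver-*ˡ []       c f = sym (ℤₚ.*-zeroʳ c)
    sumOver-*ˡ (x ∷ xs) c f rewrite sumOver-*ˡ xs c f = sym (ℤₚ.*-distribˡ-+ c (f x) _)

    sumOver-neg : ∀ (xs : List A) f → sumOver xs (λ x → - f x) ≡ - sumOver xs f
    sumOver-neg []       f = refl
    sumOver-neg (x ∷ xs) f rewrite sumOver-neg xs f = sym (ℤₚ.neg-distrib-+ (f x) _)

    sumOver-- : ∀ (xs : List A) f g → sumOver xs (λ x → f x - g x) ≡ sumOver xs f - sumOver xs g
    sumOver-- xs f g = trans (sumOver-+ xs f (-_ ∘ g)) (+-congˡ (sumOver xs f) (sumOver-neg xs g))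

    sumOver-0 : ∀ (xs : List A) {f} → (∀ x → f x ≡ + 0) → sumOver xs f ≡ + 0
    sumOver-0 []       e = refl
    sumOver-0 (x ∷ xs) e = cong₂ _+_ (e x) (sumOver-0 xs e)

    sumOver-const : ∀ (xs : List A) c → sumOver xs (λ _ → c) ≡ + length xs * c
    sumOver-const []       c = sym (ℤₚ.*-zeroˡ c)
    sumOver-const (x ∷ xs) c rewrite sumOver-const xs c = sym (ℤₚ.suc-* (+ length xs) c)

    sumOver-↭ : ∀ {xs ys : List A} (f : A → ℤ) → xs ↭ ys → sumOver xs f ≡ sumOver ys f
    sumOver-↭ f Perm.refl = refl
    sumOver-↭ f (Perm.prep x p) = +-congˡ (f x) (sumOver-↭ f p)
    sumOver-↭ f (Perm.swap x y p) rewrite sumOver-↭ f p = left-commute (f x) (f y) _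
    sumOver-↭ f (Perm.trans p q) = trans (sumOver-↭ f p) (sumOver-↭ f q)

    sumOver-map : ∀ {B : Set} (ι : B → A) ys f → sumOver (map ι ys) f ≡ sumOver ys (f ∘ ι)
    sumOver-map ι []       f = refl
    sumOver-map ι (y ∷ ys) f = +-congˡ (f (ι y)) (sumOver-map ι ys f)

    foldr≡sumOver : ∀ (xs : List A) f → foldr (λ x acc → f x + acc) (+ 0) xs ≡ sumOver xs f
    foldr≡sumOver []       f = refl
    foldr≡sumOver (x ∷ xs) f = +-congˡ (f x) (foldr≡sumOver xs f)

    unique⇒↭ : ∀ {xs ys : List A} → Unique xs → Unique ys →
      (∀ {x} → x ∈ xs → x ∈ ys) → (∀ {x} → x ∈ ys → x ∈ xs) → xs ↭ ys
    unique⇒↭ u v f g = ∼bag⇒↭ (unique∧set⇒bag u v (mk⇔ f g))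

    sumOver-filter : ∀ {P : A → Set} (P? : ∀ x → Dec (P x)) xs f →
      (∀ x → ¬ P x → f x ≡ + 0) → sumOver (filter P? xs) f ≡ sumOver xs f
    sumOver-filter P? []       f e = refl
    sumOver-filter P? (x ∷ xs) f e with P? x
    ... | yes _ = +-congˡ (f x) (sumOver-filter P? xs f e)
    ... | no ¬p = trans (sumOver-filter P? xs f e)
      (trans (sym (ℤₚ.+-identityˡ _)) (cong₂ _+_ (sym (e x ¬p)) refl))

    -- The general change of variable: `ι` enumerates without repetition the entries of `xs` that
    -- satisfy `P`, outside of which `f` vanishes. Bijections, single terms, the passage between
    -- `Fin` and `ℕ`, and the restriction of a sum to `K` are instances.
    sumOver-support : ∀ {B : Set} {P : A → Set} (P? : ∀ x → Dec (P x)) {xs ys}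
      (ι : B → A) → (∀ {x y} → ι x ≡ ι y → x ≡ y) → Unique xs → Unique ys →
      (∀ {y} → y ∈ ys → ι y ∈ xs × P (ι y)) →
      (∀ {x} → x ∈ xs → P x → ∃ λ y → y ∈ ys × x ≡ ι y) →
      (f : A → ℤ) → (∀ x → ¬ P x → f x ≡ + 0) →
      sumOver xs f ≡ sumOver ys (f ∘ ι)
    sumOver-support P? {xs} {ys} ι inj u v to from f e =
      trans (sym (sumOver-filter P? xs f e))
        (trans (sumOver-↭ f (unique⇒↭ (Uniqueₚ.filter⁺ P? u) (Uniqueₚ.map⁺ inj v) fwd bwd))
          (sumOver-map ι ys f))
      where
      fwd : ∀ {x} → x ∈ filter P? xs → x ∈ map ι ys
      fwd p with ∈-filter⁻ P? p
      ... | q , px with from q px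
      ...   | y , y∈ , refl = ∈-map⁺ ι y∈
      bwd : ∀ {x} → x ∈ map ι ys → x ∈ filter P? xs
      bwd p with ∈-map⁻ ι p
      ... | y , y∈ , refl = ∈-filter⁺ P? (proj₁ (to y∈)) (proj₂ (to y∈))

    sumOver-bijection : ∀ {xs : List A} → Unique xs → (∀ x → x ∈ xs) →
      (φ ψ : A → A) → (∀ x → φ (ψ x) ≡ x) → (∀ x → ψ (φ x) ≡ x) →
      (f : A → ℤ) → sumOver xs (f ∘ φ) ≡ sumOver xs f
    sumOver-bijection u c φ ψ φψ ψφ f =
      sym (sumOver-support {P = λ _ → ⊤} (λ _ → yes tt) φ
        (λ {x} {y} e → trans (sym (ψφ x)) (trans (cong ψ e) (ψφ y))) u u
        (λ _ → c _ , tt) (λ {x} _ _ → ψ x , c _ , sym (φψ x)) f (λ _ n → ⊥-elim (n tt)))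

    sumOver-single : ∀ (_≟_ : (x y : A) → Dec (x ≡ y)) {xs} → Unique xs → ∀ {a} → a ∈ xs →
      (f : A → ℤ) → (∀ x → ¬ x ≡ a → f x ≡ + 0) → sumOver xs f ≡ f a
    sumOver-single _≟_ u {a} a∈ f e =
      trans (sumOver-support {P = _≡ a} (_≟ a) {ys = tt ∷ []} (λ _ → a) (λ _ → refl) u ([] ∷ [])
        (λ _ → a∈ , refl) (λ {x} _ p → tt , here refl , p) f e) (ℤₚ.+-identityʳ (f a))

  sumOver-swap : ∀ {A B : Set} (xs : List A) (ys : List B) (f : A → B → ℤ) →
    sumOver xs (λ x → sumOver ys (f x)) ≡ sumOver ys (λ y → sumOver xs (λ x → f x y))
  sumOver-swap []       ys f = sym (sumOver-0 ys λ _ → refl)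
  sumOver-swap (x ∷ xs) ys f = trans (+-congˡ (sumOver ys (f x)) (sumOver-swap xs ys f))
    (sym (sumOver-+ ys (f x) _))

  sumℕ≡sumOver : ∀ n g → sumℕ n g ≡ sumOver (downFrom n) g
  sumℕ≡sumOver zero    g = refl
  sumℕ≡sumOver (suc n) g = +-congˡ (g n) (sumℕ≡sumOver n g)

  sumOver-allFin : ∀ n (g : ℕ → ℤ) → sumOver (allFin n) (g ∘ toℕ) ≡ sumℕ n g
  sumOver-allFin n g = trans (sym (sumOver-support {P = λ _ → ⊤} (λ _ → yes tt) toℕ Finₚ.toℕ-injective
      (Uniqueₚ.downFrom⁺ n) (Uniqueₚ.allFin⁺ n)
      (λ {i} _ → ∈-downFrom⁺ (Finₚ.toℕ<n i) , tt)
      (λ x∈ _ → let x<n = ∈-downFrom⁻ x∈ in Fin.fromℕ< x<n , ∈-allFin _ , sym (Finₚ.toℕ-fromℕ< x<n))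
      g (λ _ n → ⊥-elim (n tt))))
    (sym (sumℕ≡sumOver n g))

  sumℕ-cong : ∀ n {f g} → (∀ i → i ℕ.< n → f i ≡ g i) → sumℕ n f ≡ sumℕ n g
  sumℕ-cong zero    e = refl
  sumℕ-cong (suc n) e = cong₂ _+_ (e n ℕₚ.≤-refl) (sumℕ-cong n λ i i<n → e i (ℕₚ.m<n⇒m<1+n i<n))

  sumℕ-+ : ∀ n f g → sumℕ n (λ i → f i + g i) ≡ sumℕ n f + sumℕ n g
  sumℕ-+ n f g rewrite sumℕ≡sumOver n f | sumℕ≡sumOver n g | sumℕ≡sumOver n (λ i → f i + g i) =
    sumOver-+ (downFrom n) f g

  sumℕ-- : ∀ n f g → sumℕ n (λ i → f i - g i) ≡ sumℕ n f - sumℕ n g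
  sumℕ-- n f g rewrite sumℕ≡sumOver n f | sumℕ≡sumOver n g | sumℕ≡sumOver n (λ i → f i - g i) =
    sumOver-- (downFrom n) f g

  sumℕ-split : ∀ n h g → sumℕ (n ℕ.+ h) g ≡ sumℕ n (λ i → g (i ℕ.+ h)) + sumℕ h g
  sumℕ-split zero    h g = sym (ℤₚ.+-identityˡ _)
  sumℕ-split (suc n) h g rewrite sumℕ-split n h g = sym (ℤₚ.+-assoc (g (n ℕ.+ h)) _ _)

  sumℕ-single : ∀ n {a} → a ℕ.< n → (f : ℕ → ℤ) → (∀ i → ¬ i ≡ a → f i ≡ + 0) → sumℕ n f ≡ f a
  sumℕ-single n a<n f e = trans (sumℕ≡sumOver n f)
    (sumOver-single ℕ._≟_ (Uniqueₚ.downFrom⁺ n) (∈-downFrom⁺ a<n) f e)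

  -- Raising the shift by one drops the first term and adds the one a full period later, which is
  -- equal to it.
  sumℕ-shift : ∀ n g → (∀ i → g (i ℕ.+ n) ≡ g i) → ∀ σ → sumℕ n (λ i → g (i ℕ.+ σ)) ≡ sumℕ n g
  sumℕ-shift n g per zero    = sumℕ-cong n λ i _ → cong g (ℕₚ.+-identityʳ i)
  sumℕ-shift n g per (suc σ) = trans (sumℕ-cong n λ i _ → cong g (ℕₚ.+-suc i σ))
    (trans (cancel (trans (rotate n h) (trans (cong₂ _+_ hn≡h0 refl) (ℤₚ.+-comm (h 0) _))))
      (sumℕ-shift n g per σ))
    where
    h : ℕ → ℤ
    h i = g (i ℕ.+ σ)
    rotate : ∀ n h → sumℕ n (λ i → h (suc i)) + h 0 ≡ h n + sumℕ n h
    rotate zero    h = ℤₚ.+-comm (+ 0) (h 0)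
    rotate (suc n) h = trans (ℤₚ.+-assoc (h (suc n)) _ _) (+-congˡ (h (suc n)) (rotate n h))
    hn≡h0 : h n ≡ h 0
    hn≡h0 = trans (cong g (ℕₚ.+-comm n σ)) (per σ)
    cancel : ∀ {a b c} → a + c ≡ b + c → a ≡ b
    cancel {a} {b} {c} = ℤGroup.∙-cancelʳ c a b

  -- Parity and congruences of exponents.

  even⊎odd : ∀ n → (∃ λ r → n ≡ r ℕ.+ r) ⊎ (∃ λ r → n ≡ suc (r ℕ.+ r))
  even⊎odd zero    = inj₁ (0 , refl)
  even⊎odd (suc n) with even⊎odd n
  ... | inj₁ (r , refl) = inj₂ (r , refl)
  ... | inj₂ (r , refl) = inj₁ (suc r , cong suc (sym (ℕₚ.+-suc r r)))

  -- With `x = 2^k`, `x^2` is 1 modulo `x + 1`, and so is `x^(2r)`. The form `suc (c * ...)` avoids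
  -- truncated subtraction in the induction.
  2^k+1∣2^2rk∸1 : ∀ k r → ∃ λ c → 2 ℕ.^ ((r ℕ.+ r) ℕ.* k) ≡ suc (c ℕ.* (2 ℕ.^ k ℕ.+ 1))
  2^k+1∣2^2rk∸1 k zero    = 0 , refl
  2^k+1∣2^2rk∸1 k (suc r) with 2^k+1∣2^2rk∸1 k r
  ... | c , e with step (2 ℕ.^ k) c (ℕₚ.m^n>0 2 k)
    where
    -- Here `suc y` is `x`, so that `y * (x + 1)` is `x^2 - 1`.
    factor : ∀ y c → suc y ℕ.* (suc y ℕ.* suc (c ℕ.* (suc y ℕ.+ 1)))
      ≡ suc ((y ℕ.+ suc y ℕ.* suc y ℕ.* c) ℕ.* (suc y ℕ.+ 1))
    factor = ℕRing.solve-∀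
    step : ∀ x c → 0 ℕ.< x → ∃ λ c′ → x ℕ.* (x ℕ.* suc (c ℕ.* (x ℕ.+ 1))) ≡ suc (c′ ℕ.* (x ℕ.+ 1))
    step (suc y) c _ = y ℕ.+ suc y ℕ.* suc y ℕ.* c , factor y c
  ...   | c′ , e′ = c′ , (begin
      2 ℕ.^ ((suc r ℕ.+ suc r) ℕ.* k)
        ≡⟨ cong (λ n → 2 ℕ.^ (n ℕ.* k)) (cong suc (ℕₚ.+-suc r r)) ⟩
      2 ℕ.^ (k ℕ.+ (k ℕ.+ (r ℕ.+ r) ℕ.* k))
        ≡⟨ ℕₚ.^-distribˡ-+-* 2 k _ ⟩
      2 ℕ.^ k ℕ.* 2 ℕ.^ (k ℕ.+ (r ℕ.+ r) ℕ.* k)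
        ≡⟨ cong (2 ℕ.^ k ℕ.*_) (trans (ℕₚ.^-distribˡ-+-* 2 k _) (cong (2 ℕ.^ k ℕ.*_) e)) ⟩
      2 ℕ.^ k ℕ.* (2 ℕ.^ k ℕ.* suc (c ℕ.* (2 ℕ.^ k ℕ.+ 1)))
        ≡⟨ e′ ⟩
      suc (c′ ℕ.* (2 ℕ.^ k ℕ.+ 1)) ∎)
    where open ≡-Reasoning

  -- For even `q` the number `2^k + 1`, which exceeds 1, would divide both arguments of the gcd.
  coprime⇒odd : ∀ q k → gcd (2 ℕ.^ (q ℕ.* k) ℕ.∸ 1) (2 ℕ.^ k ℕ.+ 1) ≡ 1 → ∃ λ r → q ≡ suc (r ℕ.+ r)
  coprime⇒odd q k g with even⊎odd q
  ... | inj₂ odd = odd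
  ... | inj₁ (r , refl) with 2^k+1∣2^2rk∸1 k r
  ...   | c , e = ⊥-elim (ℕₚ.<⇒≢ (ℕₚ.+-monoˡ-≤ 1 (ℕₚ.m^n>0 2 k)) (sym (∣1⇒≡1
    (subst (2 ℕ.^ k ℕ.+ 1 ∣_) g (gcd-greatest (divides c (cong ℕ.pred e)) ∣-refl)))))

  -- If `2^v` is the exact power of 2 in `a`, then `σ = 2^(k-1-v)` works: `a σ` is an odd multiple
  -- of `2^(k-1)`. The recursion halves `a` and the modulus together, keeping `σ`, until `a` is odd.
  odd-multiple : ∀ k a → a ℕ.< 2 ℕ.^ k → ¬ a ≡ 0 → ∃₂ λ σ b → a ℕ.* σ ≡ 2 ℕ.^ (k ℕ.∸ 1) ℕ.+ b ℕ.* 2 ℕ.^ k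
  odd-multiple zero    zero a<1 a≢0 = ⊥-elim (a≢0 refl)
  odd-multiple zero    (suc a) (ℕ.s≤s ()) a≢0
  odd-multiple (suc k) a a<N a≢0 with even⊎odd a
  ... | inj₂ (r , refl) = 2 ℕ.^ k , r , odd r (2 ℕ.^ k)
    where
    odd : ∀ r h → suc (r ℕ.+ r) ℕ.* h ≡ h ℕ.+ r ℕ.* (2 ℕ.* h)
    odd = ℕRing.solve-∀
  odd-multiple (suc zero) a a<N a≢0 | inj₁ (zero , refl) = ⊥-elim (a≢0 refl)
  odd-multiple (suc zero) a (ℕ.s≤s (ℕ.s≤s p)) a≢0 | inj₁ (suc r , refl) rewrite ℕₚ.+-suc r r with () ← p
  odd-multiple (suc (suc k)) a a<N a≢0 | inj₁ (r , refl)
    with odd-multiple (suc k) r (half r (2 ℕ.^ suc k) a<N) (λ { refl → a≢0 refl })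
    where
    half : ∀ r h → r ℕ.+ r ℕ.< 2 ℕ.* h → r ℕ.< h
    half r h p = ℕₚ.*-cancelˡ-< 2 r h (subst (ℕ._< 2 ℕ.* h) (cong (r ℕ.+_) (sym (ℕₚ.+-identityʳ r))) p)
  ... | σ , b , e = σ , b , trans (ℕₚ.*-distribʳ-+ σ r r) (trans (cong (λ x → x ℕ.+ x) e) (double (2 ℕ.^ k) b))
    where
    double : ∀ h b → (h ℕ.+ b ℕ.* (2 ℕ.* h)) ℕ.+ (h ℕ.+ b ℕ.* (2 ℕ.* h)) ≡ 2 ℕ.* h ℕ.+ b ℕ.* (2 ℕ.* (2 ℕ.* h))
    double = ℕRing.solve-∀

  -- Modulo suc p = 2^m - 1, with x = 2^k: p ≡ -1 and x + 1 ≡ -e, so p d (x + 1) ≡ e d ≡ 1.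
  inverse-exponent : ∀ p x d → + suc p ∣ℤ (+ suc (suc p) - + x - + 2) * + d - + 1 →
    ∃₂ λ a b → p ℕ.* d ℕ.* (x ℕ.+ 1) ℕ.+ a ℕ.* suc p ≡ 1 ℕ.+ b ℕ.* suc p
  inverse-exponent p x d div with ∣ₛ.∣ᵤ⇒∣ {+ suc p} {(+ suc (suc p) - + x - + 2) * + d - + 1} div
  ... | ∣ₛ.divides z e = split (z + + x * + d) (trans product (trans (expand (+ p) (+ x) (+ d))
      (trans (cong (λ w → + 1 + (w + + x * + d * + suc p)) e) (regroup z (+ x * + d) (+ suc p)))))
    where
    X : ℕ
    X = p ℕ.* d ℕ.* (x ℕ.+ 1)
    product : + X ≡ + p * + d * (+ x + + 1)
    product = trans (ℤₚ.pos-* (p ℕ.* d) (x ℕ.+ 1)) (cong₂ _*_ (ℤₚ.pos-* p d) (ℤₚ.pos-+ x 1))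
    expand : ∀ p x d → p * d * (x + + 1)
      ≡ + 1 + (((+ 1 + (+ 1 + p) - x - + 2) * d - + 1) + x * d * (+ 1 + p))
    expand = solve-∀
    regroup : ∀ z y M → + 1 + (z * M + y * M) ≡ + 1 + (z + y) * M
    regroup = solve-∀
    cancel : ∀ c M → + 1 + - c * M + c * M ≡ + 1
    cancel = solve-∀
    split : ∀ w → + X ≡ + 1 + w * + suc p → ∃₂ λ a b → X ℕ.+ a ℕ.* suc p ≡ 1 ℕ.+ b ℕ.* suc p
    split (+ b) eq = 0 , b , trans (ℕₚ.+-identityʳ X)
      (ℤₚ.+-injective (trans eq (+-congˡ (+ 1) (sym (ℤₚ.pos-* b (suc p))))))
    split ℤ.-[1+ c ] eq = suc c , 0 , ℤₚ.+-injective (trans (ℤₚ.pos-+ X _)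
      (trans (cong₂ _+_ eq (ℤₚ.pos-* (suc c) (suc p))) (cancel (+ suc c) (+ suc p))))

  -- Monomials in the cyclotomic ring.

  δ : ℕ → ℕ → ℤ
  δ i j = if does (i ℕ.≟ j) then + 1 else + 0

  δ-≡ : ∀ i → δ i i ≡ + 1
  δ-≡ i = cong (λ b → if b then + 1 else + 0) (dec-true (i ℕ.≟ i) refl)

  δ-≢ : ∀ {i j} → ¬ i ≡ j → δ i j ≡ + 0
  δ-≢ {i} {j} i≢j = cong (λ b → if b then + 1 else + 0) (dec-false (i ℕ.≟ j) i≢j)

  δ-+ : ∀ i j n → δ (i ℕ.+ n) (j ℕ.+ n) ≡ δ i j
  δ-+ i j n with i ℕ.≟ j
  ... | yes refl = trans (δ-≡ (i ℕ.+ n)) (sym (δ-≡ i))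
  ... | no i≢j   = trans (δ-≢ (i≢j ∘ ℕₚ.+-cancelʳ-≡ n i j)) (sym (δ-≢ i≢j))

  module _ (h : ℕ) where

    private
      H N : ℕ
      H = 2 ℕ.^ h
      N = 2 ℕ.^ suc h

      instance
        N≢0 : NonZero N
        N≢0 = ℕₚ.m^n≢0 2 (suc h)

      N≡H+H : N ≡ H ℕ.+ H
      N≡H+H = cong (H ℕ.+_) (ℕₚ.+-identityʳ H)

      0<H : 0 ℕ.< H
      0<H = ℕₚ.m^n>0 2 h

      <H⇒<N : ∀ {i} → i ℕ.< H → i ℕ.< N
      <H⇒<N i<H = ℕₚ.≤-trans i<H (subst (H ℕ.≤_) (sym N≡H+H) (ℕₚ.m≤m+n H H))

      <N : ∀ {i} → i ℕ.< H → i ℕ.+ H ℕ.< N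
      <N {i} i<H = subst (i ℕ.+ H ℕ.<_) (sym N≡H+H) (ℕₚ.+-monoˡ-< H i<H)

      <H⊎ : ∀ i → i ℕ.< N → i ℕ.< H ⊎ (∃ λ j → i ≡ j ℕ.+ H × j ℕ.< H)
      <H⊎ i i<N with i ℕ.<? H
      ... | yes i<H = inj₁ i<H
      ... | no i≮H  = inj₂ (i ℕ.∸ H , sym (ℕₚ.m∸n+n≡m H≤i) , ℕₚ.+-cancelʳ-< H _ _
          (subst₂ ℕ._<_ (sym (ℕₚ.m∸n+n≡m H≤i)) N≡H+H i<N))
        where H≤i = ℕₚ.≮⇒≥ i≮H

    -- Adding `H` modulo `N = 2H` exchanges the lower and the upper half of the residues, and
    -- `j < H` places `j` and `j + H` in opposite halves.
    antiperiodic-δ : ∀ i j → j ℕ.< H → δ ((i ℕ.+ H) % N) (j ℕ.+ H) ≡ δ (i % N) j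
    antiperiodic-δ i j j<H = trans (cong (λ r → δ r (j ℕ.+ H)) residue) (step (i % N) (m%n<n i N))
      where
      residue : (i ℕ.+ H) % N ≡ (i % N ℕ.+ H) % N
      residue = trans (%-distribˡ-+ i H N) (cong (λ z → (i % N ℕ.+ z) % N) (m<n⇒m%n≡m (<N 0<H)))
      wrap : ∀ s → s ℕ.< H → (s ℕ.+ H ℕ.+ H) % N ≡ s
      wrap s s<H = trans (cong (_% N) (trans (ℕₚ.+-assoc s H H) (cong (s ℕ.+_) (sym N≡H+H))))
        (trans ([m+n]%n≡m%n s N) (m<n⇒m%n≡m (<H⇒<N s<H)))
      step : ∀ r → r ℕ.< N → δ ((r ℕ.+ H) % N) (j ℕ.+ H) ≡ δ r j
      step r r<N with <H⊎ r r<N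
      ... | inj₁ r<H = trans (cong (λ z → δ z (j ℕ.+ H)) (m<n⇒m%n≡m (<N r<H))) (δ-+ r j H)
      ... | inj₂ (s , refl , s<H) = trans
          (δ-≢ λ e → ℕₚ.<⇒≱ s<H (subst (H ℕ.≤_) (trans (sym e) (wrap s s<H)) (ℕₚ.m≤n+m H j)))
          (sym (δ-≢ λ e → ℕₚ.<⇒≱ j<H (subst (H ℕ.≤_) e (ℕₚ.m≤n+m H s))))

    -- Translating `i` by a `σ` with `a σ` congruent to `H` carries the indices counted at `j` to
    -- those counted at `j + H`. This is where `a` nonzero enters, and it supplies the balanced
    -- weights.
    residues-balanced : ∀ a → a ℕ.< N → ¬ a ≡ 0 → ∀ j → j ℕ.< H →
      sumOver (allFin N) (λ i → δ ((a ℕ.* toℕ i) % N) j - δ ((a ℕ.* toℕ i) % N) (j ℕ.+ H)) ≡ + 0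
    residues-balanced a a<N a≢0 j j<H with odd-multiple (suc h) a a<N a≢0
    ... | σ , b , aσ = begin
      sumOver (allFin N) (λ i → g (toℕ i) - g′ (toℕ i)) ≡⟨ sumOver-allFin N (λ i → g i - g′ i) ⟩
      sumℕ N (λ i → g i - g′ i)                         ≡⟨ sumℕ-- N g g′ ⟩
      sumℕ N g - sumℕ N g′                              ≡⟨ cong (λ z → sumℕ N g - z) (sumℕ-shift N g′ periodic σ) ⟨
      sumℕ N g - sumℕ N (λ i → g′ (i ℕ.+ σ))            ≡⟨ cong (λ z → sumℕ N g - z) (sumℕ-cong N λ i _ → shift i) ⟩
      sumℕ N g - sumℕ N g                               ≡⟨ ℤₚ.+-inverseʳ (sumℕ N g) ⟩
      + 0                                               ∎
      where
      open ≡-Reasoning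
      g g′ : ℕ → ℤ
      g  i = δ ((a ℕ.* i) % N) j
      g′ i = δ ((a ℕ.* i) % N) (j ℕ.+ H)
      periodic : ∀ i → g′ (i ℕ.+ N) ≡ g′ i
      periodic i = cong (λ r → δ r (j ℕ.+ H))
        (trans (cong (_% N) (ℕₚ.*-distribˡ-+ a i N)) ([m+kn]%n≡m%n (a ℕ.* i) a N))
      shift : ∀ i → g′ (i ℕ.+ σ) ≡ g i
      shift i = trans (cong (λ r → δ r (j ℕ.+ H)) residue) (antiperiodic-δ (a ℕ.* i) j j<H)
        where
        residue : (a ℕ.* (i ℕ.+ σ)) % N ≡ (a ℕ.* i ℕ.+ H) % N
        residue = trans (cong (_% N) (trans (ℕₚ.*-distribˡ-+ a i σ)
          (trans (cong (a ℕ.* i ℕ.+_) aσ) (sym (ℕₚ.+-assoc (a ℕ.* i) H (b ℕ.* N))))))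
          ([m+kn]%n≡m%n (a ℕ.* i ℕ.+ H) b N)

    -- The hypothesis says that `c` represents `M ζ^p`, whose absolute square is `M * M`. But
    -- `normSq` works with raw coefficients and not with classes modulo `ζ^H = -1`, so its value
    -- must first be expressed through the differences of `c`.
    normSq-monomial : ∀ (c : Coeffs) M p → p ℕ.< N →
      (∀ j → j ℕ.< H → c j - c (j ℕ.+ H) ≡ M * (δ p j - δ p (j ℕ.+ H))) →
      CycloEq (suc h) (normSq (suc h) c) (constC (M * M))
    normSq-monomial c M p p<N c-eq t t<H = begin
      sumℕ N (λ i → c i * c ((i ℕ.+ (N ℕ.∸ t % N)) % N))
        - sumℕ N (λ i → c i * c ((i ℕ.+ (N ℕ.∸ (t ℕ.+ H) % N)) % N))
        ≡⟨ sumℕ-- N _ _ ⟨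
      sumℕ N (λ i → c i * c ((i ℕ.+ (N ℕ.∸ t % N)) % N) - c i * c ((i ℕ.+ (N ℕ.∸ (t ℕ.+ H) % N)) % N))
        ≡⟨ sumℕ-cong N (λ i _ → cong₂ (λ v w → c i * c ((i ℕ.+ v) % N) - c i * c ((i ℕ.+ w) % N)) lag₁ lag₂) ⟩
      sumℕ N (λ i → c i * c ((i ℕ.+ (τ ℕ.+ H)) % N) - c i * c ((i ℕ.+ τ) % N))
        ≡⟨ sumℕ-cong N (λ i _ → trans (neg-distrib (c i) _ _)
             (cong (λ z → - (c i * (c ((i ℕ.+ τ) % N) - c (z % N)))) (sym (ℕₚ.+-assoc i τ H)))) ⟩
      sumℕ N (λ i → - (c i * E (i ℕ.+ τ)))
        ≡⟨ cong (λ n → sumℕ n (λ i → - (c i * E (i ℕ.+ τ)))) N≡H+H ⟩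
      sumℕ (H ℕ.+ H) (λ i → - (c i * E (i ℕ.+ τ)))
        ≡⟨ sumℕ-split H H _ ⟩
      sumℕ H (λ i → - (c (i ℕ.+ H) * E (i ℕ.+ H ℕ.+ τ))) + sumℕ H (λ i → - (c i * E (i ℕ.+ τ)))
        ≡⟨ sumℕ-+ H _ _ ⟨
      sumℕ H (λ i → - (c (i ℕ.+ H) * E (i ℕ.+ H ℕ.+ τ)) + - (c i * E (i ℕ.+ τ)))
        ≡⟨ sumℕ-cong H pair ⟩
      sumℕ H (λ i → - (E i * E (i ℕ.+ τ)))
        ≡⟨ finish (<H⊎ p p<N) ⟩
      constC (M * M) t
        ≡⟨ ℤₚ.+-identityʳ _ ⟨
      constC (M * M) t - + 0
        ≡⟨ cong (λ z → constC (M * M) t - z) (constC-+H t) ⟨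
      constC (M * M) t - constC (M * M) (t ℕ.+ H) ∎
      where
      open ≡-Reasoning
      τ : ℕ
      τ = H ℕ.∸ t
      -- normSq sees c only through E, which changes sign under a shift by H because ζ^H = -1.
      E : ℕ → ℤ
      E i = c (i % N) - c ((i ℕ.+ H) % N)
      lag₁ : N ℕ.∸ t % N ≡ τ ℕ.+ H
      lag₁ = trans (cong₂ ℕ._∸_ N≡H+H (m<n⇒m%n≡m (<H⇒<N t<H))) (ℕₚ.+-∸-comm H (ℕₚ.<⇒≤ t<H))
      lag₂ : N ℕ.∸ (t ℕ.+ H) % N ≡ τ
      lag₂ = trans (cong₂ ℕ._∸_ N≡H+H (trans (m<n⇒m%n≡m (<N t<H)) (ℕₚ.+-comm t H))) (ℕₚ.[m+n]∸[m+o]≡n∸o H H t)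
      neg-distrib : ∀ a b c → a * b - a * c ≡ - (a * (c - b))
      neg-distrib = solve-∀
      constC-+H : ∀ t → constC (M * M) (t ℕ.+ H) ≡ + 0
      constC-+H t with t ℕ.+ H | ℕₚ.≤-trans 0<H (ℕₚ.m≤n+m H t)
      ... | suc _ | _ = refl
      E-anti : ∀ i → E (i ℕ.+ H) ≡ - E i
      E-anti i = trans (cong (λ z → c ((i ℕ.+ H) % N) - c z)
          (trans (cong (_% N) (trans (ℕₚ.+-assoc i H H) (cong (i ℕ.+_) (sym N≡H+H)))) ([m+n]%n≡m%n i N)))
        (neg-swap (c ((i ℕ.+ H) % N)) _)
        where
        neg-swap : ∀ a b → a - b ≡ - (b - a)
        neg-swap = solve-∀
      E-small : ∀ i → i ℕ.< H → E i ≡ c i - c (i ℕ.+ H)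
      E-small i i<H = cong₂ (λ u v → c u - c v) (m<n⇒m%n≡m (<H⇒<N i<H)) (m<n⇒m%n≡m (<N i<H))
      -- The terms at `i` and `i + H` share the factor `E (i + τ)` up to sign; collecting it leaves
      -- the difference of the coefficients, which is `E i`.
      pair : ∀ i → i ℕ.< H →
        - (c (i ℕ.+ H) * E (i ℕ.+ H ℕ.+ τ)) + - (c i * E (i ℕ.+ τ)) ≡ - (E i * E (i ℕ.+ τ))
      pair i i<H = trans (cong (λ z → - (c (i ℕ.+ H) * z) + - (c i * E (i ℕ.+ τ)))
          (trans (cong E (trans (ℕₚ.+-assoc i H τ) (trans (cong (i ℕ.+_) (ℕₚ.+-comm H τ)) (sym (ℕₚ.+-assoc i τ H)))))
            (E-anti (i ℕ.+ τ))))
        (trans (collect (c i) (c (i ℕ.+ H)) _) (cong (λ z → - (z * E (i ℕ.+ τ))) (sym (E-small i i<H))))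
        where
        collect : ∀ a b e → - (b * - e) + - (a * e) ≡ - ((a - b) * e)
        collect = solve-∀
      -- Both halves of the range of `p` are treated together: `ζ^p` is `ε ζ^s` with `s < H` and a
      -- sign `ε`, so below `H` the function `E` is supported at `s`.
      module _ (s : ℕ) (s<H : s ℕ.< H) (ε : ℤ) (εε : ε * ε ≡ + 1)
               (E-δ : ∀ i → i ℕ.< H → E i ≡ ε * M * δ s i) where
        E-s : E s ≡ ε * M
        E-s = trans (E-δ s s<H) (trans (cong (ε * M *_) (δ-≡ s)) (ℤₚ.*-identityʳ _))
        E-≢ : ∀ i → i ℕ.< H → ¬ i ≡ s → E i ≡ + 0
        E-≢ i i<H i≢s = trans (E-δ i i<H) (trans (cong (ε * M *_) (δ-≢ (i≢s ∘ sym))) (ℤₚ.*-zeroʳ (ε * M)))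
        single : sumℕ H (λ i → - (E i * E (i ℕ.+ τ))) ≡ - (E s * E (s ℕ.+ τ))
        single = trans (sumℕ-cong H {g = λ i → δ s i * - (E s * E (s ℕ.+ τ))} term)
          (trans (sumℕ-single H s<H _ λ i i≢s → cong (_* - (E s * E (s ℕ.+ τ))) (δ-≢ (i≢s ∘ sym)))
            (trans (cong (_* - (E s * E (s ℕ.+ τ))) (δ-≡ s)) (ℤₚ.*-identityˡ _)))
          where
          term : ∀ i → i ℕ.< H → - (E i * E (i ℕ.+ τ)) ≡ δ s i * - (E s * E (s ℕ.+ τ))
          term i i<H with s ℕ.≟ i
          ... | yes refl = sym (trans (cong (_* - (E i * E (i ℕ.+ τ))) (δ-≡ i)) (ℤₚ.*-identityˡ _))
          ... | no s≢i   = trans (cong (λ z → - (z * E (i ℕ.+ τ))) (E-≢ i i<H (s≢i ∘ sym)))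
              (sym (cong (_* - (E s * E (s ℕ.+ τ))) (δ-≢ s≢i)))
        -- Only lag `H`, that is `t = 0`, returns to `s` modulo `H`, and there the sign change of
        -- `E` cancels the leading minus.
        lagged : ∀ t → t ℕ.< H → - (E s * E (s ℕ.+ (H ℕ.∸ t))) ≡ constC (M * M) t
        lagged zero    _ = trans (cong (λ z → - (E s * z)) (E-anti s))
          (trans (cong (λ z → - (z * - z)) E-s) (trans (square ε M) (trans (cong (_* (M * M)) εε) (ℤₚ.*-identityˡ _))))
          where
          square : ∀ e M → - (e * M * - (e * M)) ≡ e * e * (M * M)
          square = solve-∀
        lagged (suc t) t<H = trans (cong (λ z → - (E s * z)) vanish) (cong -_ (ℤₚ.*-zeroʳ (E s)))
          where
          vanish : E (s ℕ.+ (H ℕ.∸ suc t)) ≡ + 0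
          -- If the lagged index reaches `H`, antiperiodicity folds it back to `s - (t + 1)`, below
          -- `s`; otherwise it already lies below `H` and above `s`.
          vanish with suc t ℕ.≤? s
          ... | yes t≤s = trans (cong E (trans (sym (ℕₚ.+-∸-assoc s (ℕₚ.<⇒≤ t<H))) (ℕₚ.+-∸-comm H t≤s)))
              (trans (E-anti (s ℕ.∸ suc t)) (cong -_ (E-≢ _ (ℕₚ.≤-<-trans (ℕₚ.m∸n≤m s (suc t)) s<H)
                λ e → ℕₚ.<⇒≢ (ℕₚ.∸-monoʳ-< (ℕ.s≤s ℕ.z≤n) t≤s) e)))
          ... | no t≰s = E-≢ _ (subst (ℕ._< H) (ℕₚ.+-∸-assoc s (ℕₚ.<⇒≤ t<H)) (ℕₚ.m<n+o⇒m∸n<o _ (suc t) {{ℕₚ.m^n≢0 2 h}} (ℕₚ.+-monoˡ-< H (ℕₚ.≰⇒> t≰s))))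
              λ e → ℕₚ.<⇒≢ (ℕₚ.m<m+n s (ℕₚ.m<n⇒0<n∸m t<H)) (sym e)
        finish′ : sumℕ H (λ i → - (E i * E (i ℕ.+ τ))) ≡ constC (M * M) t
        finish′ = trans single (lagged t t<H)
      finish : p ℕ.< H ⊎ (∃ λ j → p ≡ j ℕ.+ H × j ℕ.< H) → _
      finish (inj₁ p<H) = finish′ p p<H (+ 1) refl λ i i<H → trans (E-small i i<H) (trans (c-eq i i<H)
        (trans (cong (λ z → M * (δ p i - z)) (δ-≢ λ e → ℕₚ.<⇒≱ p<H (subst (H ℕ.≤_) (sym e) (ℕₚ.m≤n+m H i))))
          (unit M (δ p i))))
        where
        unit : ∀ M d → M * (d - + 0) ≡ + 1 * M * d
        unit = solve-∀
      finish (inj₂ (s , refl , s<H)) = finish′ s s<H (- + 1) refl λ i i<H → trans (E-small i i<H) (trans (c-eq i i<H)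
        (trans (cong₂ (λ y z → M * (y - z)) (δ-≢ λ e → ℕₚ.<⇒≱ i<H (subst (H ℕ.≤_) e (ℕₚ.m≤n+m H s))) (δ-+ s i H))
          (unit M (δ s i))))
        where
        unit : ∀ M d → M * (+ 0 - d) ≡ - + 1 * M * d
        unit = solve-∀

open Arithmetic

-- Algebra in characteristic 2.

module FieldTheory {m : ℕ} (F : GF2^ m) where

  open GF2^ F
  open IsCommutativeRing isCommutativeRing using
    (+-assoc; +-comm; +-identityˡ; +-identityʳ; *-assoc; *-comm; *-identityˡ; *-identityʳ;
     distribˡ; distribʳ; zeroˡ; zeroʳ; *-isCommutativeMonoid)

  ring : CommutativeRing _ _
  ring = record { isCommutativeRing = isCommutativeRing }

  open Solver (fromCommutativeRing ring λ _ → nothing) using (solve; _⊜_; _⊕_; _⊗_)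

  x+x≡0 : ∀ x → x + x ≡ 0#
  x+x≡0 x = trans (cong₂ _+_ (sym (*-identityʳ x)) (sym (*-identityʳ x)))
    (trans (sym (distribˡ x 1# 1#)) (trans (cong (x *_) char2) (zeroʳ x)))

  cancel-middle : ∀ x y z → (x + y) + (y + z) ≡ x + z
  cancel-middle x y z = trans (+-assoc x y (y + z))
    (cong (x +_) (trans (sym (+-assoc y y z)) (trans (cong (_+ z) (x+x≡0 y)) (+-identityˡ z))))

  x+[x+y]≡y : ∀ x y → x + (x + y) ≡ y
  x+[x+y]≡y x y = trans (sym (+-assoc x x y)) (trans (cong (_+ y) (x+x≡0 x)) (+-identityˡ y))

  x+y≡0⇒x≡y : ∀ {x y} → x + y ≡ 0# → x ≡ y
  x+y≡0⇒x≡y {x} {y} e = sym (trans (sym (x+[x+y]≡y x y)) (trans (cong (x +_) e) (+-identityʳ x)))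

  *-cancelˡ : ∀ {x y z} → ¬ x ≡ 0# → x * y ≡ x * z → y ≡ z
  *-cancelˡ {x} {y} {z} x≢0 e with inverse x x≢0
  ... | x⁻¹ , xx⁻¹ = trans (recover y) (trans (cong (x⁻¹ *_) e) (sym (recover z)))
    where
    recover : ∀ w → w ≡ x⁻¹ * (x * w)
    recover w = sym (trans (sym (*-assoc x⁻¹ x w))
      (trans (cong (_* w) (trans (*-comm x⁻¹ x) xx⁻¹)) (*-identityˡ w)))

  *-≢0 : ∀ {x y} → ¬ x ≡ 0# → ¬ y ≡ 0# → ¬ x * y ≡ 0#
  *-≢0 x≢0 y≢0 e = y≢0 (*-cancelˡ x≢0 (trans e (sym (zeroʳ _))))

  ^-+ : ∀ x a b → x ^ (a ℕ.+ b) ≡ x ^ a * x ^ b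
  ^-+ x zero    b = sym (*-identityˡ _)
  ^-+ x (suc a) b = trans (cong (x *_) (^-+ x a b)) (sym (*-assoc x _ _))

  *-^ : ∀ x y n → (x * y) ^ n ≡ x ^ n * y ^ n
  *-^ x y zero    = sym (*-identityˡ _)
  *-^ x y (suc n) = trans (cong (x * y *_) (*-^ x y n))
    (solve 4 (λ x y u v → (x ⊗ y ⊗ (u ⊗ v)) ⊜ (x ⊗ u ⊗ (y ⊗ v))) refl x y (x ^ n) (y ^ n))

  1^ : ∀ n → 1# ^ n ≡ 1#
  1^ zero    = refl
  1^ (suc n) = trans (*-identityˡ _) (1^ n)

  ^-* : ∀ x a b → x ^ (a ℕ.* b) ≡ (x ^ a) ^ b
  ^-* x zero    b = sym (1^ b)
  ^-* x (suc a) b = trans (^-+ x b (a ℕ.* b)) (trans (cong (x ^ b *_) (^-* x a b)) (sym (*-^ x (x ^ a) b)))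

  ^-comm : ∀ x a b → (x ^ a) ^ b ≡ (x ^ b) ^ a
  ^-comm x a b = trans (sym (^-* x a b)) (trans (cong (x ^_) (ℕₚ.*-comm a b)) (^-* x b a))

  ^-≢0 : ∀ {x} n → ¬ x ≡ 0# → ¬ x ^ n ≡ 0#
  ^-≢0 zero    x≢0 = 1≢0
  ^-≢0 (suc n) x≢0 = *-≢0 x≢0 (^-≢0 n x≢0)

  0^ : ∀ {n} → 0 ℕ.< n → 0# ^ n ≡ 0#
  0^ {suc n} _ = zeroˡ _

  ^2 : ∀ x → x ^ 2 ≡ x * x
  ^2 x = cong (x *_) (*-identityʳ x)

  frobenius-+ : ∀ i x y → (x + y) ^ (2 ℕ.^ i) ≡ x ^ (2 ℕ.^ i) + y ^ (2 ℕ.^ i)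
  frobenius-+ zero    x y = trans (*-identityʳ _) (sym (cong₂ _+_ (*-identityʳ x) (*-identityʳ y)))
  frobenius-+ (suc i) x y = trans (^-* (x + y) 2 (2 ℕ.^ i)) (trans (cong (_^ (2 ℕ.^ i)) square)
    (trans (frobenius-+ i (x ^ 2) (y ^ 2)) (sym (cong₂ _+_ (^-* x 2 (2 ℕ.^ i)) (^-* y 2 (2 ℕ.^ i))))))
    where
    square : (x + y) ^ 2 ≡ x ^ 2 + y ^ 2
    square = trans (^2 (x + y)) (trans
      (solve 2 (λ x y → ((x ⊕ y) ⊗ (x ⊕ y)) ⊜ ((x ⊗ x ⊕ x ⊗ y) ⊕ (x ⊗ y ⊕ y ⊗ y))) refl x y)
      (trans (cancel-middle (x * x) (x * y) (y * y)) (sym (cong₂ _+_ (^2 x) (^2 y)))))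

  ^-2^-+ : ∀ x i j → x ^ (2 ℕ.^ (i ℕ.+ j)) ≡ (x ^ (2 ℕ.^ i)) ^ (2 ℕ.^ j)
  ^-2^-+ x i j = trans (cong (x ^_) (ℕₚ.^-distribˡ-+-* 2 i j)) (^-* x (2 ℕ.^ i) (2 ℕ.^ j))

  sumF-cong : ∀ n {f g} → (∀ i → f i ≡ g i) → sumF n f ≡ sumF n g
  sumF-cong zero    e = refl
  sumF-cong (suc n) e = cong₂ _+_ (e n) (sumF-cong n e)

  sumF-+ : ∀ n f g → sumF n (λ i → f i + g i) ≡ sumF n f + sumF n g
  sumF-+ zero    f g = sym (+-identityˡ 0#)
  sumF-+ (suc n) f g = trans (cong (f n + g n +_) (sumF-+ n f g))
    (solve 4 (λ x y u v → ((x ⊕ y) ⊕ (u ⊕ v)) ⊜ ((x ⊕ u) ⊕ (y ⊕ v))) refl (f n) (g n) (sumF n f) (sumF n g))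

  sumF-*ˡ : ∀ n c f → sumF n (λ i → c * f i) ≡ c * sumF n f
  sumF-*ˡ zero    c f = sym (zeroʳ c)
  sumF-*ˡ (suc n) c f = trans (cong (c * f n +_) (sumF-*ˡ n c f)) (sym (distribˡ c _ _))

  sumF-frobenius : ∀ n f i → sumF n f ^ (2 ℕ.^ i) ≡ sumF n (λ j → f j ^ (2 ℕ.^ i))
  sumF-frobenius zero    f i = 0^ (ℕₚ.m^n>0 2 i)
  sumF-frobenius (suc n) f i = trans (frobenius-+ i (f n) (sumF n f)) (cong (f n ^ (2 ℕ.^ i) +_) (sumF-frobenius n f i))

  sumF-telescope : ∀ n (f : ℕ → Carrier) → sumF n (λ i → f i + f (suc i)) ≡ f 0 + f n
  sumF-telescope zero    f = sym (x+x≡0 (f 0))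
  sumF-telescope (suc n) f = trans (+-comm _ _) (trans (cong (_+ (f n + f (suc n))) (sumF-telescope n f))
    (cancel-middle (f 0) (f n) (f (suc n))))

  -- The parity of `m / k` acts through this: `tr-K` and `Tr-tr` both add up `q` equal terms.
  sumF-odd : ∀ r c → sumF (suc (r ℕ.+ r)) (λ _ → c) ≡ c
  sumF-odd zero    c = +-identityʳ c
  sumF-odd (suc r) c rewrite ℕₚ.+-suc r r = trans (x+[x+y]≡y c _) (sumF-odd r c)

  -- The multiplicative group and Fermat's theorem.

  product : List Carrier → Carrier
  product = foldr _*_ 1#

  product-↭ : ∀ {xs ys} → xs ↭ ys → product xs ≡ product ys
  product-↭ p = Permₛ.foldr-commMonoid (setoid Carrier) *-isCommutativeMonoid (↭⇒↭ₛ p)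

  product-map-* : ∀ c xs → product (map (c *_) xs) ≡ c ^ length xs * product xs
  product-map-* c []       = sym (*-identityˡ 1#)
  product-map-* c (x ∷ xs) = trans (cong (c * x *_) (product-map-* c xs))
    (solve 4 (λ x y u v → (x ⊗ y ⊗ (u ⊗ v)) ⊜ (x ⊗ u ⊗ (y ⊗ v))) refl c x (c ^ length xs) (product xs))

  nonzero? : ∀ x → Dec (¬ x ≡ 0#)
  nonzero? x = ¬? (x ≟ 0#)

  units : List Carrier
  units = filter nonzero? elems

  ∈-units : ∀ {x} → ¬ x ≡ 0# → x ∈ units
  ∈-units x≢0 = ∈-filter⁺ nonzero? (complete _) x≢0

  units-≢0 : ∀ {x} → x ∈ units → ¬ x ≡ 0#
  units-≢0 x∈ = proj₂ (∈-filter⁻ nonzero? {xs = elems} x∈)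

  size-units : 2 ℕ.^ m ≡ suc (length units)
  size-units = trans (sym size) (Permₚ.↭-length (unique⇒↭ unique
    (Allₚ.¬Any⇒All¬ units (λ 0∈ → units-≢0 0∈ refl) ∷ Uniqueₚ.filter⁺ nonzero? unique)
    (λ {x} _ → split x) (λ _ → complete _)))
    where
    split : ∀ x → x ∈ 0# ∷ units
    split x with x ≟ 0#
    ... | yes x≡0 = here x≡0
    ... | no x≢0  = there (∈-units x≢0)

  product-units-≢0 : ¬ product units ≡ 0#
  product-units-≢0 = go units units-≢0
    where
    go : ∀ xs → (∀ {x} → x ∈ xs → ¬ x ≡ 0#) → ¬ product xs ≡ 0#
    go []       _ = 1≢0
    go (x ∷ xs) h = *-≢0 (h (here refl)) (go xs (h ∘ there))

  -- Multiplication by `x` permutes the units, so it does not change their product, while it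
  -- multiplies that product by `x` once for each unit.
  unit-order : ∀ {x} → ¬ x ≡ 0# → x ^ length units ≡ 1#
  unit-order {x} x≢0 = *-cancelˡ product-units-≢0
    (trans (*-comm _ _) (trans (sym (product-map-* x units))
      (trans (product-↭ permuted) (sym (*-identityʳ _)))))
    where
    permuted : map (x *_) units ↭ units
    permuted = unique⇒↭ (Uniqueₚ.map⁺ (*-cancelˡ x≢0) (Uniqueₚ.filter⁺ nonzero? unique))
      (Uniqueₚ.filter⁺ nonzero? unique) fwd bwd
      where
      fwd : ∀ {y} → y ∈ map (x *_) units → y ∈ units
      fwd y∈ with ∈-map⁻ (x *_) y∈
      ... | z , z∈ , refl = ∈-units (*-≢0 x≢0 (units-≢0 z∈))
      bwd : ∀ {y} → y ∈ units → y ∈ map (x *_) units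
      bwd {y} y∈ with inverse x x≢0
      ... | x⁻¹ , xx⁻¹ = subst (_∈ map (x *_) units) xx⁻¹y
          (∈-map⁺ (x *_) (∈-units λ e → units-≢0 y∈ (trans (sym xx⁻¹y) (trans (cong (x *_) e) (zeroʳ x)))))
        where
        xx⁻¹y : x * (x⁻¹ * y) ≡ y
        xx⁻¹y = trans (sym (*-assoc x x⁻¹ y)) (trans (cong (_* y) xx⁻¹) (*-identityˡ y))

  fermat : ∀ x → x ^ (2 ℕ.^ m) ≡ x
  fermat x with x ≟ 0#
  ... | yes refl = 0^ (ℕₚ.m^n>0 2 m)
  ... | no x≢0   = trans (cong (x ^_) size-units) (trans (cong (x *_) (unit-order x≢0)) (*-identityʳ x))

  -- A field with `2^0` elements would have no units, yet `1#` is one.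
  degree≥1 : 0 ℕ.< m
  degree≥1 = ℕₚ.n≢0⇒n>0 λ m≡0 → nonempty (∈-units 1≢0)
      (ℕₚ.suc-injective (trans (sym size-units) (cong (2 ℕ.^_) m≡0)))
    where
    nonempty : ∀ {x} {xs : List Carrier} → x ∈ xs → ¬ length xs ≡ 0
    nonempty (here _)  ()
    nonempty (there _) ()

  -- Polynomial functions and the number of their roots.

  Poly : ℕ → (Carrier → Carrier) → Set
  Poly zero    f = ∀ x → f x ≡ 0#
  Poly (suc n) f = ∃₂ λ c g → Poly n g × ∀ x → f x ≡ c + x * g x

  -- `Poly n` stands for degree below `n`, `Monic n` for monic of degree exactly `n`. Nested Horner
  -- form makes division by a linear factor a structural recursion.
  Monic : ℕ → (Carrier → Carrier) → Set
  Monic zero    f = ∀ x → f x ≡ 1#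
  Monic (suc n) f = ∃₂ λ c g → Monic n g × ∀ x → f x ≡ c + x * g x

  horner-+ : ∀ c g d h x → (c + x * g) + (d + x * h) ≡ (c + d) + x * (g + h)
  horner-+ c g d h x = solve 5
    (λ c g d h x → ((c ⊕ x ⊗ g) ⊕ (d ⊕ x ⊗ h)) ⊜ ((c ⊕ d) ⊕ x ⊗ (g ⊕ h))) refl c g d h x

  Poly-0 : ∀ n → Poly n (λ _ → 0#)
  Poly-0 zero    = λ _ → refl
  Poly-0 (suc n) = 0# , _ , Poly-0 n , λ x → sym (trans (+-identityˡ _) (zeroʳ x))

  Poly-weaken : ∀ {a b} → a ℕ.≤ b → ∀ {f} → Poly a f → Poly b f
  Poly-weaken {b = zero}  ℕ.z≤n e = e
  Poly-weaken {b = suc b} ℕ.z≤n e = 0# , _ , Poly-0 b , λ x → trans (e x) (sym (trans (+-identityˡ _) (zeroʳ x)))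
  Poly-weaken (ℕ.s≤s a≤b) (c , g , p , e) = c , g , Poly-weaken a≤b p , e

  Poly-+ : ∀ n {f g} → Poly n f → Poly n g → Poly n (λ x → f x + g x)
  Poly-+ zero    e e′ x = trans (cong₂ _+_ (e x) (e′ x)) (+-identityˡ 0#)
  Poly-+ (suc n) (c , g , p , e) (c′ , g′ , p′ , e′) = c + c′ , _ , Poly-+ n p p′ ,
    λ x → trans (cong₂ _+_ (e x) (e′ x)) (horner-+ c (g x) c′ (g′ x) x)

  Poly-* : ∀ n a {f} → Poly n f → Poly n (λ x → a * f x)
  Poly-* zero    a e x = trans (cong (a *_) (e x)) (zeroʳ a)
  Poly-* (suc n) a (c , g , p , e) = a * c , _ , Poly-* n a p , λ x → trans (cong (a *_) (e x))
    (solve 4 (λ a c x g → (a ⊗ (c ⊕ x ⊗ g)) ⊜ (a ⊗ c ⊕ x ⊗ (a ⊗ g))) refl a c x (g x))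

  Monic⇒Poly : ∀ n {f} → Monic n f → Poly (suc n) f
  Monic⇒Poly zero    e = 1# , _ , Poly-0 0 , λ x → trans (e x) (sym (trans (cong (1# +_) (zeroʳ x)) (+-identityʳ 1#)))
  Monic⇒Poly (suc n) (c , g , p , e) = c , g , Monic⇒Poly n p , e

  Monic-+ : ∀ n {f g} → Monic n f → Poly n g → Monic n (λ x → f x + g x)
  Monic-+ zero    e e′ x = trans (cong₂ _+_ (e x) (e′ x)) (+-identityʳ 1#)
  Monic-+ (suc n) (c , g , p , e) (c′ , g′ , p′ , e′) = c + c′ , _ , Monic-+ n p p′ ,
    λ x → trans (cong₂ _+_ (e x) (e′ x)) (horner-+ c (g x) c′ (g′ x) x)

  Monic-^ : ∀ n → Monic n (_^ n)
  Monic-^ zero    = λ _ → refl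
  Monic-^ (suc n) = 0# , _ , Monic-^ n , λ x → sym (+-identityˡ _)

  -- Synthetic division: if `f x = c + x * h x` and `h x + h r = (x + r) * h′`, then `h x + r * h′`
  -- is the quotient of `f`. Signs disappear in characteristic 2.
  factor : ∀ n {f} → Monic (suc n) f → ∀ r → ∃ λ g → Monic n g × ∀ x → f x + f r ≡ (x + r) * g x
  factor n {f} (c , h , monic , e) r = quotient n monic
    where
    expand : ∀ h′ x → h x + h r ≡ (x + r) * h′ → f x + f r ≡ (x + r) * (h x + r * h′)
    expand h′ x e′ = begin
      f x + f r                              ≡⟨ cong₂ _+_ (trans (e x) (+-comm c _)) (e r) ⟩
      (x * h x + c) + (c + r * h r)          ≡⟨ cancel-middle _ _ _ ⟩
      x * h x + r * h r                      ≡⟨ cancel-middle _ (r * h x) _ ⟨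
      (x * h x + r * h x) + (r * h x + r * h r)
        ≡⟨ solve 4 (λ x r a b → ((x ⊗ a ⊕ r ⊗ a) ⊕ (r ⊗ a ⊕ r ⊗ b)) ⊜ ((x ⊕ r) ⊗ a ⊕ r ⊗ (a ⊕ b)))
             refl x r (h x) (h r) ⟩
      (x + r) * h x + r * (h x + h r)        ≡⟨ cong (λ z → (x + r) * h x + r * z) e′ ⟩
      (x + r) * h x + r * ((x + r) * h′)
        ≡⟨ solve 4 (λ x r a b → ((x ⊕ r) ⊗ a ⊕ r ⊗ ((x ⊕ r) ⊗ b)) ⊜ ((x ⊕ r) ⊗ (a ⊕ r ⊗ b)))
             refl x r (h x) h′ ⟩
      (x + r) * (h x + r * h′)               ∎
      where open ≡-Reasoning
    quotient : ∀ n → Monic n h → ∃ λ g → Monic n g × ∀ x → f x + f r ≡ (x + r) * g x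
    quotient zero    monic = _ , Monic-+ zero monic (λ _ → zeroʳ r) , λ x →
      expand 0# x (trans (cong₂ _+_ (monic x) (monic r)) (trans char2 (sym (zeroʳ _))))
    quotient (suc n) monic with factor n monic r
    ... | h′ , monic′ , e′ = _ , Monic-+ (suc n) monic (Poly-* (suc n) r (Monic⇒Poly n monic′)) ,
      λ x → expand (h′ x) x (e′ x)

  root-bound : ∀ n {f} → Monic n f → ∀ {xs} → Unique xs → All (λ x → f x ≡ 0#) xs → length xs ℕ.≤ n
  root-bound n       monic []       [] = ℕ.z≤n
  root-bound zero    monic (_ ∷ _)  (e ∷ _) = ⊥-elim (1≢0 (trans (sym (monic _)) e))
  root-bound (suc n) monic {r ∷ _} (r≢ ∷ u) (e ∷ es) with factor n monic r
  ... | g , monic′ , e′ = ℕ.s≤s (root-bound n monic′ u (All.zipWith root (r≢ , es)))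
    where
    root : ∀ {x} → ¬ r ≡ x × _ ≡ 0# → g x ≡ 0#
    root {x} (r≢x , fx) with g x ≟ 0#
    ... | yes gx = gx
    ... | no gx  = ⊥-elim (*-≢0 (λ z → r≢x (sym (x+y≡0⇒x≡y z))) gx
      (trans (sym (e′ x)) (trans (cong₂ _+_ fx e) (+-identityˡ 0#))))

  -- For positive `n` the leading term is `z^(2^(n-1))`; the generous bound `2^n` is what makes
  -- these terms lower order next to `z^(2^n)` in `Tr-nontrivial`.
  Poly-trace : ∀ n → Poly (2 ℕ.^ n) (λ z → sumF n (λ i → z ^ (2 ℕ.^ i)))
  Poly-trace zero    = Poly-0 1
  Poly-trace (suc n) = Poly-+ (2 ℕ.^ suc n)
    (Poly-weaken (ℕₚ.^-monoʳ-< 2 (ℕ.s≤s (ℕ.s≤s ℕ.z≤n)) (ℕₚ.n<1+n n)) (Monic⇒Poly (2 ℕ.^ n) (Monic-^ (2 ℕ.^ n))))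
    (Poly-weaken (ℕₚ.^-monoʳ-≤ 2 (ℕₚ.n≤1+n n)) (Poly-trace n))

  -- The absolute trace and its sign character.

  Tr-+ : ∀ x y → Tr (x + y) ≡ Tr x + Tr y
  Tr-+ x y = trans (sumF-cong m λ i → frobenius-+ i x y) (sumF-+ m _ _)

  Tr-0 : Tr 0# ≡ 0#
  Tr-0 = trans (cong Tr (sym char2)) (trans (Tr-+ 1# 1#) (x+x≡0 (Tr 1#)))

  Tr-square : ∀ z → Tr (z ^ 2) ≡ Tr z
  Tr-square z = trans (sumF-cong m λ i → sym (^-* z 2 (2 ℕ.^ i))) (sym (x+y≡0⇒x≡y (begin
    sumF m f + sumF m (f ∘ suc)        ≡⟨ sumF-+ m f (f ∘ suc) ⟨
    sumF m (λ i → f i + f (suc i))     ≡⟨ sumF-telescope m f ⟩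
    z ^ 1 + z ^ (2 ℕ.^ m)              ≡⟨ cong₂ _+_ (*-identityʳ z) (fermat z) ⟩
    z + z                              ≡⟨ x+x≡0 z ⟩
    0#                                 ∎)))
    where
    open ≡-Reasoning
    f : ℕ → Carrier
    f i = z ^ (2 ℕ.^ i)

  Tr-frobenius : ∀ z j → Tr (z ^ (2 ℕ.^ j)) ≡ Tr z
  Tr-frobenius z zero    = cong Tr (*-identityʳ z)
  Tr-frobenius z (suc j) = trans (cong Tr (^-* z 2 (2 ℕ.^ j))) (trans (Tr-frobenius (z ^ 2) j) (Tr-square z))

  -- Squaring permutes the conjugates of `z`, so `Tr z` is idempotent. This makes `sign`
  -- multiplicative.
  Tr-0⊎1 : ∀ z → Tr z ≡ 0# ⊎ Tr z ≡ 1#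
  Tr-0⊎1 z with Tr z ≟ 0#
  ... | yes e = inj₁ e
  ... | no n  = inj₂ (*-cancelˡ n (trans idempotent (sym (*-identityʳ _))))
    where
    idempotent : Tr z * Tr z ≡ Tr z
    idempotent = trans (sym (^2 (Tr z))) (trans (sumF-frobenius m _ 1)
      (trans (sumF-cong m λ i → ^-comm z (2 ℕ.^ i) 2) (Tr-square z)))

  -- The trace is a monic polynomial of degree `2^(m-1)`, too small to vanish at all `2^m` elements.
  -- Searching `elems` yields an actual witness.
  Tr-nontrivial : ∃ λ z → ¬ Tr z ≡ 0#
  Tr-nontrivial with All.all? (λ z → Tr z ≟ 0#) elems
  ... | no ¬all = Any.satisfied (Allₚ.¬All⇒Any¬ (λ z → Tr z ≟ 0#) elems ¬all)
  ... | yes all = ⊥-elim (bound m refl degree≥1)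
    where
    bound : ∀ n → n ≡ m → ¬ 0 ℕ.< n
    bound (suc n) e _ = ℕₚ.<⇒≱ (ℕₚ.^-monoʳ-< 2 (ℕ.s≤s (ℕ.s≤s ℕ.z≤n)) (ℕₚ.n<1+n n))
      (subst (ℕ._≤ 2 ℕ.^ n) (trans size (cong (2 ℕ.^_) (sym e)))
        (root-bound (2 ℕ.^ n) (Monic-+ _ (Monic-^ (2 ℕ.^ n)) (Poly-trace n)) unique
          (All.map (λ {z} t → trans (cong (λ l → sumF l (λ i → z ^ (2 ℕ.^ i))) e) t) all)))

  sign-Tr≡0 : ∀ {z} → Tr z ≡ 0# → sign z ≡ ℤ.1ℤ
  sign-Tr≡0 {z} e = cong (λ b → if b then ℤ.1ℤ else ℤ.-1ℤ) (dec-true (Tr z ≟ 0#) e)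

  sign-Tr≢0 : ∀ {z} → ¬ Tr z ≡ 0# → sign z ≡ ℤ.-1ℤ
  sign-Tr≢0 {z} n = cong (λ b → if b then ℤ.1ℤ else ℤ.-1ℤ) (dec-false (Tr z ≟ 0#) n)

  sign-cong-Tr : ∀ {x y} → Tr x ≡ Tr y → sign x ≡ sign y
  sign-cong-Tr {x} {y} e = cong (λ t → if does (t ≟ 0#) then ℤ.1ℤ else ℤ.-1ℤ) e

  sign-0 : sign 0# ≡ ℤ.1ℤ
  sign-0 = sign-Tr≡0 Tr-0

  sign-+ : ∀ x y → sign (x + y) ≡ sign x ℤ.* sign y
  sign-+ x y with Tr-0⊎1 x | Tr-0⊎1 y
  ... | inj₁ ex | _       = trans (sign-cong-Tr (trans (Tr-+ x y) (trans (cong (_+ Tr y) ex) (+-identityˡ _))))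
      (sym (trans (cong (ℤ._* sign y) (sign-Tr≡0 ex)) (ℤₚ.*-identityˡ _)))
  ... | inj₂ _  | inj₁ ey = trans (sign-cong-Tr (trans (Tr-+ x y) (trans (cong (Tr x +_) ey) (+-identityʳ _))))
      (sym (trans (cong (sign x ℤ.*_) (sign-Tr≡0 ey)) (ℤₚ.*-identityʳ _)))
  ... | inj₂ ex | inj₂ ey = trans (sign-Tr≡0 (trans (Tr-+ x y) (trans (cong₂ _+_ ex ey) char2)))
      (sym (cong₂ ℤ._*_ (sign-Tr≢0 (1≢0 ∘ trans (sym ex))) (sign-Tr≢0 (1≢0 ∘ trans (sym ey)))))

  sqrt : Carrier → Carrier
  sqrt x = x ^ (2 ℕ.^ (m ℕ.∸ 1))

  sqrt-^2 : ∀ x → sqrt x ^ 2 ≡ x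
  sqrt-^2 x = trans (sym (^-2^-+ x (m ℕ.∸ 1) 1))
    (trans (cong (λ n → x ^ (2 ℕ.^ n)) (ℕₚ.m∸n+n≡m degree≥1)) (fermat x))

  -- The subfield and the relative trace.

  module Subfield (k r : ℕ) (m≡qk : m ≡ suc (r ℕ.+ r) ℕ.* k) where

    q : ℕ
    q = suc (r ℕ.+ r)

    K : Carrier → Set
    K = InSubfield k

    K? : ∀ x → Dec (K x)
    K? x = (x ^ (2 ℕ.^ k)) ≟ x

    tr : Carrier → Carrier
    tr = relTr k q

    K-+ : ∀ {x y} → K x → K y → K (x + y)
    K-+ {x} {y} kx ky = trans (frobenius-+ k x y) (cong₂ _+_ kx ky)

    K-^ : ∀ {x} n → K x → K (x ^ n)
    K-^ {x} n kx = trans (^-comm x n (2 ℕ.^ k)) (cong (_^ n) kx)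

    K-frobenius : ∀ {x} i → K x → x ^ (2 ℕ.^ (i ℕ.* k)) ≡ x
    K-frobenius {x} zero    kx = *-identityʳ x
    K-frobenius {x} (suc i) kx = trans (^-2^-+ x k (i ℕ.* k))
      (trans (cong (_^ (2 ℕ.^ (i ℕ.* k))) kx) (K-frobenius i kx))

    tr-+ : ∀ x y → tr (x + y) ≡ tr x + tr y
    tr-+ x y = trans (sumF-cong q λ i → frobenius-+ (i ℕ.* k) x y) (sumF-+ q _ _)

    -- The power `2^k` shifts the conjugates of `s` by one place, and `s^(2^m) = s` closes the
    -- cycle; the sum of the old and the new trace telescopes to zero.
    tr∈K : ∀ s → K (tr s)
    tr∈K s = trans (sumF-frobenius q f k) (trans (sumF-cong q shift) (sym (x+y≡0⇒x≡y (begin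
      sumF q f + sumF q (f ∘ suc)     ≡⟨ sumF-+ q f (f ∘ suc) ⟨
      sumF q (λ i → f i + f (suc i))  ≡⟨ sumF-telescope q f ⟩
      s ^ 1 + s ^ (2 ℕ.^ (q ℕ.* k))   ≡⟨ cong (λ n → s ^ 1 + s ^ (2 ℕ.^ n)) m≡qk ⟨
      s ^ 1 + s ^ (2 ℕ.^ m)           ≡⟨ cong₂ _+_ (*-identityʳ s) (fermat s) ⟩
      s + s                           ≡⟨ x+x≡0 s ⟩
      0#                              ∎))))
      where
      open ≡-Reasoning
      f : ℕ → Carrier
      f i = s ^ (2 ℕ.^ (i ℕ.* k))
      shift : ∀ i → f i ^ (2 ℕ.^ k) ≡ f (suc i)
      shift i = trans (sym (^-2^-+ s (i ℕ.* k) k)) (cong (λ n → s ^ (2 ℕ.^ n)) (ℕₚ.+-comm (i ℕ.* k) k))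

    tr-K : ∀ {x} → K x → tr x ≡ x
    tr-K {x} kx = trans (sumF-cong q λ i → K-frobenius i kx) (sumF-odd r x)

    -- For `w` in `K`, the conjugates of `w * s` are `w` times those of `s`. They all have the same
    -- absolute trace, and their number is odd.
    Tr-tr : ∀ {w} s → K w → Tr (w * tr s) ≡ Tr (w * s)
    Tr-tr {w} s kw = begin
      Tr (w * tr s)                                      ≡⟨ cong Tr (sumF-*ˡ q w _) ⟨
      Tr (sumF q (λ i → w * s ^ (2 ℕ.^ (i ℕ.* k))))      ≡⟨ Tr-sumF q _ ⟩
      sumF q (λ i → Tr (w * s ^ (2 ℕ.^ (i ℕ.* k))))      ≡⟨ sumF-cong q conjugate ⟩
      sumF q (λ _ → Tr (w * s))                          ≡⟨ sumF-odd r _ ⟩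
      Tr (w * s)                                         ∎
      where
      open ≡-Reasoning
      Tr-sumF : ∀ n f → Tr (sumF n f) ≡ sumF n (Tr ∘ f)
      Tr-sumF zero    f = Tr-0
      Tr-sumF (suc n) f = trans (Tr-+ (f n) _) (cong (Tr (f n) +_) (Tr-sumF n f))
      conjugate : ∀ i → Tr (w * s ^ (2 ℕ.^ (i ℕ.* k))) ≡ Tr (w * s)
      conjugate i = trans (cong (λ v → Tr (v * s ^ (2 ℕ.^ (i ℕ.* k)))) (sym (K-frobenius i kw)))
        (trans (cong Tr (sym (*-^ w s (2 ℕ.^ (i ℕ.* k))))) (Tr-frobenius (w * s) (i ℕ.* k)))

    tr-kernel : ∀ z → tr (z + z ^ (2 ℕ.^ k)) ≡ 0#
    tr-kernel z = trans (tr-+ z _) (trans (cong (tr z +_) conjugate) (x+x≡0 (tr z)))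
      where
      conjugate : tr (z ^ (2 ℕ.^ k)) ≡ tr z
      conjugate = trans (sumF-cong q λ i → ^-comm z (2 ℕ.^ k) (2 ℕ.^ (i ℕ.* k)))
        (trans (sym (sumF-frobenius q _ k)) (tr∈K z))

    -- The exponent inverts `x ↦ x^(2^k)`: with `q - 1 = r + r`, the two powers compose to `2^m`.
    conjugate-root : ∀ w → (w ^ (2 ℕ.^ ((r ℕ.+ r) ℕ.* k))) ^ (2 ℕ.^ k) ≡ w
    conjugate-root w = trans (sym (^-2^-+ w ((r ℕ.+ r) ℕ.* k) k))
      (trans (cong (λ n → w ^ (2 ℕ.^ n)) (trans (ℕₚ.+-comm ((r ℕ.+ r) ℕ.* k) k) (sym m≡qk))) (fermat w))

    -- With w = w′^(2^k), the element z + z^(2^k) of the kernel of tr pairs with w as z pairs with w + w′.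
    kernel-detects : ∀ {w} → ¬ K w → ∃ λ s → tr s ≡ 0# × ¬ Tr (w * s) ≡ 0#
    kernel-detects {w} w∉K with Tr-nontrivial
    ... | z₀ , Tr-z₀ with inverse (w + w ^ (2 ℕ.^ ((r ℕ.+ r) ℕ.* k))) (λ e → w∉K (trans (cong (_^ (2 ℕ.^ k)) (x+y≡0⇒x≡y e)) (conjugate-root w)))
    ...   | v , v-inverse = z + z ^ (2 ℕ.^ k) , tr-kernel z , λ e → Tr-z₀ (trans (sym pairing) e)
      where
      z w′ : Carrier
      z  = v * z₀
      w′ = w ^ (2 ℕ.^ ((r ℕ.+ r) ℕ.* k))
      pairing : Tr (w * (z + z ^ (2 ℕ.^ k))) ≡ Tr z₀
      pairing = begin
        Tr (w * (z + z ^ (2 ℕ.^ k)))                    ≡⟨ cong Tr (distribˡ w z _) ⟩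
        Tr (w * z + w * z ^ (2 ℕ.^ k))                  ≡⟨ Tr-+ _ _ ⟩
        Tr (w * z) + Tr (w * z ^ (2 ℕ.^ k))             ≡⟨ cong (λ t → Tr (w * z) + Tr (t * z ^ (2 ℕ.^ k))) (conjugate-root w) ⟨
        Tr (w * z) + Tr (w′ ^ (2 ℕ.^ k) * z ^ (2 ℕ.^ k)) ≡⟨ cong (Tr (w * z) +_) (trans (cong Tr (sym (*-^ w′ z (2 ℕ.^ k)))) (Tr-frobenius (w′ * z) k)) ⟩
        Tr (w * z) + Tr (w′ * z)                        ≡⟨ Tr-+ _ _ ⟨
        Tr (w * z + w′ * z)                             ≡⟨ cong Tr (distribʳ z w w′) ⟨
        Tr ((w + w′) * (v * z₀))                        ≡⟨ cong Tr (*-assoc (w + w′) v z₀) ⟨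
        Tr ((w + w′) * v * z₀)                          ≡⟨ cong (λ t → Tr (t * z₀)) v-inverse ⟩
        Tr (1# * z₀)                                    ≡⟨ cong Tr (*-identityˡ z₀) ⟩
        Tr z₀                                           ∎
        where open ≡-Reasoning

-- Weighted correlations and the reduction of bentness.

module _ {m : ℕ} (F : GF2^ m) where

  open GF2^ F

  -- The Walsh sum with an integer weight in place of the root of unity; indicator weights give the
  -- coefficients in `walsh`.
  correlation : ∀ {n} → (Carrier → Carrier → Fin n) → (Fin n → ℤ) → Carrier → Carrier → ℤ
  correlation f G u v = sumOver elems λ x → sumOver elems λ y → G (f x y) ℤ.* sign (u * x + v * y)

  -- The index `i₀` is chosen before `G`, so one value serves all coefficients and all `a`; it is
  -- the dual function at `(u, v)`.
  Concentrated : ∀ {n} → (Carrier → Carrier → Fin n) → Set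
  Concentrated {n} f = ∀ u v → ∃ λ i₀ → ∀ G → sumOver (allFin n) G ≡ ℤ.0ℤ →
    correlation f G u v ≡ ℤ.+ (2 ℕ.^ m) ℤ.* G i₀

  Concentrated-flip : ∀ {n} (f : Carrier → Carrier → Fin n) → Concentrated f → Concentrated (flip f)
  Concentrated-flip f concentrated u v with concentrated v u
  ... | i₀ , e = i₀ , λ G balanced → trans (trans (sumOver-swap elems elems _)
    (sumOver-cong elems λ y → sumOver-cong elems λ x →
      cong (λ t → G (f y x) ℤ.* sign t) (IsCommutativeRing.+-comm isCommutativeRing (u * x) (v * y)))) (e G balanced)

  walsh-correlation : ∀ k f a u v j → walsh F k f a u v j ≡ correlation f (λ i → δ (modPow2 k (a ℕ.* toℕ i)) j) u v
  walsh-correlation k f a u v j = trans (foldr≡sumOver elems _) (sumOver-cong elems λ x →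
    trans (foldr≡sumOver elems _) (sumOver-cong elems λ y →
      select (does (modPow2 k (a ℕ.* toℕ (f x y)) ℕ.≟ j)) (sign (u * x + v * y))))
    where
    select : ∀ b z → (if b then z else ℤ.0ℤ) ≡ (if b then ℤ.1ℤ else ℤ.0ℤ) ℤ.* z
    select true  z = sym (ℤₚ.*-identityˡ z)
    select false z = refl

  correlation-- : ∀ {n} (f : Carrier → Carrier → Fin n) G G′ u v →
    correlation f G u v ℤ.- correlation f G′ u v ≡ correlation f (λ i → G i ℤ.- G′ i) u v
  correlation-- f G G′ u v = trans (sym (sumOver-- elems _ _)) (sumOver-cong elems λ x →
    trans (sym (sumOver-- elems _ _)) (sumOver-cong elems λ y → factor-out (G (f x y)) (G′ (f x y)) _))
    where
    factor-out : ∀ a b c → a ℤ.* c ℤ.- b ℤ.* c ≡ (a ℤ.- b) ℤ.* c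
    factor-out = solve-∀

  concentrated⇒bent : ∀ k f → Concentrated f → IsBent F k f
  concentrated⇒bent zero    f _ zero    _            a≢0 = ⊥-elim (a≢0 refl)
  concentrated⇒bent zero    f _ (suc a) (ℕ.s≤s ())   a≢0
  concentrated⇒bent (suc h) f concentrated a a<N a≢0 u v with concentrated u v
  ... | i₀ , e = subst (λ M → CycloEq (suc h) (normSq (suc h) W) (constC M)) 2^m*2^m
      (normSq-monomial h W (ℤ.+ (2 ℕ.^ m)) (residue i₀) (m%n<n _ (2 ℕ.^ suc h) {{ℕₚ.m^n≢0 2 (suc h)}}) λ j j<H →
        trans (cong₂ ℤ._-_ (walsh-correlation (suc h) f a u v j) (walsh-correlation (suc h) f a u v (j ℕ.+ 2 ℕ.^ h)))
          (trans (correlation-- f (G j) (G (j ℕ.+ 2 ℕ.^ h)) u v) (e (λ i → G j i ℤ.- G (j ℕ.+ 2 ℕ.^ h) i) (residues-balanced h a a<N a≢0 j j<H))))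
    where
    W : Coeffs
    W = walsh F (suc h) f a u v
    residue : Fin (2 ℕ.^ suc h) → ℕ
    residue i = modPow2 (suc h) (a ℕ.* toℕ i)
    G : ℕ → Fin (2 ℕ.^ suc h) → ℤ
    G j i = δ (residue i) j
    2^m*2^m : ℤ.+ (2 ℕ.^ m) ℤ.* ℤ.+ (2 ℕ.^ m) ≡ ℤ.+ (4 ℕ.^ m)
    2^m*2^m = trans (sym (ℤₚ.pos-* (2 ℕ.^ m) (2 ℕ.^ m))) (cong ℤ.+_ (trans (sym (ℕₚ.^-distribˡ-+-* 2 m m))
      (trans (cong (λ n → 2 ℕ.^ (m ℕ.+ n)) (sym (ℕₚ.+-identityʳ m))) (sym (ℕₚ.^-*-assoc 2 2 m)))))

-- Character sums over the field and over the subfield.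

module Concentration {m : ℕ} (F : GF2^ m) (k r : ℕ) (m≡qk : m ≡ suc (r ℕ.+ r) ℕ.* k)
    (π : Fin (2 ℕ.^ k) → GF2^.Carrier F)
    (π∈K : ∀ i → GF2^.InSubfield F k (π i))
    (π-injective : Injective _≡_ _≡_ π)
    (π-surjective : ∀ γ → GF2^.InSubfield F k γ → ∃ λ i → π i ≡ γ) where

  open GF2^ F
  open FieldTheory F
  open Subfield k r m≡qk
  open IsCommutativeRing isCommutativeRing using
    (+-assoc; +-comm; +-identityˡ; +-identityʳ; *-assoc; *-comm; *-identityˡ; *-identityʳ; distribˡ; zeroˡ; zeroʳ)
  open ≡-Reasoning

  N : ℕ
  N = 2 ℕ.^ k

  sumC : (Carrier → ℤ) → ℤ
  sumC = sumOver elems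

  sumK : (Fin N → ℤ) → ℤ
  sumK = sumOver (allFin N)

  -- The value that the bent function takes on the curve with parameter `s`.
  idx : Carrier → Fin N
  idx s = proj₁ (π-surjective (tr s) (tr∈K s))

  π-idx : ∀ s → π (idx s) ≡ tr s
  π-idx s = proj₂ (π-surjective (tr s) (tr∈K s))

  idx-unique : ∀ {s i} → tr s ≡ π i → idx s ≡ i
  idx-unique {s} e = π-injective (trans (π-idx s) e)

  tr-+π : ∀ s i → tr (s + π i) ≡ tr s + π i
  tr-+π s i = trans (tr-+ s (π i)) (cong (tr s +_) (tr-K (π∈K i)))

  -- As `tr` is additive and fixes `K`, the map `i ↦ idx (s + π i)` is translation of `K` by `tr s`
  -- read through `π`, an involution.
  sumK-translate : ∀ s (Φ : Fin N → ℤ) → sumK (λ i → Φ (idx (s + π i))) ≡ sumK Φ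
  sumK-translate s Φ = sumOver-bijection (Uniqueₚ.allFin⁺ N) ∈-allFin shift shift involutive involutive Φ
    where
    shift : Fin N → Fin N
    shift i = idx (s + π i)
    π-shift : ∀ i → π (shift i) ≡ tr s + π i
    π-shift i = trans (π-idx _) (tr-+π s i)
    involutive : ∀ i → shift (shift i) ≡ i
    involutive i = π-injective (trans (π-shift (shift i)) (trans (cong (tr s +_) (π-shift i)) (x+[x+y]≡y (tr s) (π i))))

  sumC-translate : ∀ s₀ g → sumC (λ s → g (s + s₀)) ≡ sumC g
  sumC-translate s₀ g = sumOver-bijection unique complete (_+ s₀) (_+ s₀) involutive involutive g
    where
    involutive : ∀ s → s + s₀ + s₀ ≡ s
    involutive s = trans (+-assoc s s₀ s₀) (trans (cong (s +_) (x+x≡0 s₀)) (+-identityʳ s))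

  sumC-const : ∀ c → sumC (λ _ → c) ≡ ℤ.+ (2 ℕ.^ m) ℤ.* c
  sumC-const c = trans (sumOver-const elems c) (cong (λ n → ℤ.+ n ℤ.* c) size)

  sumK-const : ∀ c → sumK (λ _ → c) ≡ ℤ.+ N ℤ.* c
  sumK-const c = trans (sumOver-const (allFin N) c) (cong (λ n → ℤ.+ n ℤ.* c) (Listₚ.length-tabulate {n = N} id))

  N-cancel : ∀ {x y} → ℤ.+ N ℤ.* x ≡ ℤ.+ N ℤ.* y → x ≡ y
  N-cancel {x} {y} = ℤₚ.*-cancelˡ-≡ (ℤ.+ N) x y {{ℕₚ.m^n≢0 2 k}}

  -- Used for `sum-sign`, `sumK-sign` and `T-off-K`, where a translation of the variable turns the
  -- sum into its negative.
  ≡-neg⇒≡0 : ∀ x → x ≡ ℤ.- x → x ≡ ℤ.0ℤ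
  ≡-neg⇒≡0 (ℤ.+ zero) _ = refl

  sign-flip : ∀ {w s₀} s → ¬ Tr (w * s₀) ≡ 0# → sign (w * (s + s₀)) ≡ ℤ.- sign (w * s)
  sign-flip {w} {s₀} s n = begin
    sign (w * (s + s₀))             ≡⟨ cong sign (distribˡ w s s₀) ⟩
    sign (w * s + w * s₀)           ≡⟨ sign-+ _ _ ⟩
    sign (w * s) ℤ.* sign (w * s₀)  ≡⟨ cong (sign (w * s) ℤ.*_) (sign-Tr≢0 n) ⟩
    sign (w * s) ℤ.* ℤ.-1ℤ          ≡⟨ ℤₚ.*-comm (sign (w * s)) ℤ.-1ℤ ⟩
    ℤ.-1ℤ ℤ.* sign (w * s)          ≡⟨ ℤₚ.-1*i≡-i _ ⟩
    ℤ.- sign (w * s)                ∎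

  Tr-detects : ∀ {c} → ¬ c ≡ 0# → ∃ λ z → ¬ Tr (c * z) ≡ 0#
  Tr-detects {c} c≢0 with Tr-nontrivial | inverse c c≢0
  ... | z , Tr-z | c⁻¹ , cc⁻¹ = c⁻¹ * z , λ e → Tr-z (trans (cong Tr (sym
    (trans (sym (*-assoc c c⁻¹ z)) (trans (cong (_* z) cc⁻¹) (*-identityˡ z))))) e)

  sum-sign : ∀ {c} → ¬ c ≡ 0# → sumC (λ s → sign (c * s)) ≡ ℤ.0ℤ
  sum-sign {c} c≢0 with Tr-detects c≢0
  ... | z , n = ≡-neg⇒≡0 _ (begin
    sumC (λ s → sign (c * s))          ≡⟨ sumC-translate z (λ s → sign (c * s)) ⟨
    sumC (λ s → sign (c * (s + z)))    ≡⟨ sumOver-cong elems (λ s → sign-flip s n) ⟩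
    sumC (λ s → ℤ.- sign (c * s))      ≡⟨ sumOver-neg elems _ ⟩
    ℤ.- sumC (λ s → sign (c * s))      ∎)

  -- An element `z` detected by `c` may lie outside `K`, but `tr z` lies in `K` and pairs with `c`
  -- in the same way, so translation by `tr z` flips the sign.
  sumK-sign : ∀ {c} → K c → ¬ c ≡ 0# → sumK (λ i → sign (c * π i)) ≡ ℤ.0ℤ
  sumK-sign {c} kc c≢0 with Tr-detects c≢0
  ... | z , n = ≡-neg⇒≡0 _ (begin
    sumK (λ i → sign (c * π i))               ≡⟨ sumK-translate z (λ i → sign (c * π i)) ⟨
    sumK (λ i → sign (c * π (idx (z + π i)))) ≡⟨ sumOver-cong (allFin N) flipped ⟩
    sumK (λ i → ℤ.- sign (c * π i))           ≡⟨ sumOver-neg (allFin N) _ ⟩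
    ℤ.- sumK (λ i → sign (c * π i))           ∎)
    where
    flipped : ∀ i → sign (c * π (idx (z + π i))) ≡ ℤ.- sign (c * π i)
    flipped i = trans (sign-cong-Tr (trans (cong (λ t → Tr (c * t)) (π-idx _)) (Tr-tr _ kc)))
      (trans (cong (λ t → sign (c * t)) (+-comm z (π i))) (sign-flip (π i) n))

  T : (Fin N → ℤ) → Carrier → ℤ
  T G w = sumC λ s → G (idx s) ℤ.* sign (w * s)

  -- Translation by an element of the kernel of `tr` preserves `idx`; off `K` some such element
  -- flips the sign.
  T-off-K : ∀ G w → ¬ K w → T G w ≡ ℤ.0ℤ
  T-off-K G w w∉K = vanish (kernel-detects w∉K)
    where
    g : Carrier → ℤ
    g s = G (idx s) ℤ.* sign (w * s)
    vanish : (∃ λ s₀ → tr s₀ ≡ 0# × ¬ Tr (w * s₀) ≡ 0#) → T G w ≡ ℤ.0ℤ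
    vanish (s₀ , tr-s₀ , n) = ≡-neg⇒≡0 _ (begin
      sumC g                       ≡⟨ sumC-translate s₀ g ⟨
      sumC (λ s → g (s + s₀))      ≡⟨ sumOver-cong elems flipped ⟩
      sumC (λ s → ℤ.- g s)         ≡⟨ sumOver-neg elems g ⟩
      ℤ.- sumC g                   ∎)
      where
      flipped : ∀ s → g (s + s₀) ≡ ℤ.- g s
      flipped s = trans (cong₂ (λ i σ → G i ℤ.* σ)
          (idx-unique (trans (tr-+ s s₀) (trans (cong (tr s +_) tr-s₀) (trans (+-identityʳ _) (sym (π-idx s))))))
          (sign-flip s n))
        (sym (ℤₚ.neg-distribʳ-* (G (idx s)) (sign (w * s))))

  -- Averaging over the translates s ↦ s + π i avoids counting the fibres of tr.
  T-on-K : ∀ G w → K w → ℤ.+ N ℤ.* T G w ≡ ℤ.+ (2 ℕ.^ m) ℤ.* sumK (λ j → G j ℤ.* sign (w * π j))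
  T-on-K G w kw = begin
    ℤ.+ N ℤ.* T G w                                ≡⟨ sumK-const (T G w) ⟨
    sumK (λ i → T G w)                             ≡⟨ sumOver-cong (allFin N) translate ⟩
    sumK (λ i → sumC λ s → Φ (idx (s + π i)))      ≡⟨ sumOver-swap (allFin N) elems (λ i s → Φ (idx (s + π i))) ⟩
    sumC (λ s → sumK λ i → Φ (idx (s + π i)))      ≡⟨ sumOver-cong elems (λ s → sumK-translate s Φ) ⟩
    sumC (λ s → sumK Φ)                            ≡⟨ sumC-const (sumK Φ) ⟩
    ℤ.+ (2 ℕ.^ m) ℤ.* sumK Φ                       ∎
    where
    Φ : Fin N → ℤ
    Φ j = G j ℤ.* sign (w * π j)
    through-idx : ∀ s → G (idx s) ℤ.* sign (w * s) ≡ Φ (idx s)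
    through-idx s = cong (G (idx s) ℤ.*_)
      (sign-cong-Tr (trans (sym (Tr-tr s kw)) (cong (λ t → Tr (w * t)) (sym (π-idx s)))))
    translate : ∀ i → T G w ≡ sumC (λ s → Φ (idx (s + π i)))
    translate i = trans (sumOver-cong elems {g = Φ ∘ idx} through-idx) (sym (sumC-translate (π i) (Φ ∘ idx)))

  K-0 : K 0#
  K-0 = 0^ (ℕₚ.m^n>0 2 k)

  -- At zero the character is trivial, so `T` is a multiple of the total of `G`. This disposes of
  -- all rows with `x` nonzero when `v` is zero.
  T-0 : ∀ G → sumK G ≡ ℤ.0ℤ → T G 0# ≡ ℤ.0ℤ
  T-0 G balanced = N-cancel (trans (T-on-K G 0# K-0) (trans (cong (ℤ.+ (2 ℕ.^ m) ℤ.*_)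
    (trans (sumOver-cong (allFin N) λ j → trans (cong (G j ℤ.*_) (trans (cong sign (zeroˡ (π j))) sign-0))
      (ℤₚ.*-identityʳ (G j))) balanced)) (trans (ℤₚ.*-zeroʳ (ℤ.+ (2 ℕ.^ m))) (sym (ℤₚ.*-zeroʳ (ℤ.+ N))))))

  -- On `K`, `T` is `2^m / N` times the Fourier transform of `G`, and the sum over `i` is the
  -- inverse transform at `tr b`. Multiplying by `N` keeps everything integral.
  concentrated-sum : ∀ G b → sumK (λ i → sign (π i * b) ℤ.* T G (π i)) ≡ ℤ.+ (2 ℕ.^ m) ℤ.* G (idx b)
  concentrated-sum G b = N-cancel (begin
    ℤ.+ N ℤ.* sumK (λ i → sign (π i * b) ℤ.* T G (π i))
      ≡⟨ sumOver-*ˡ (allFin N) (ℤ.+ N) _ ⟨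
    sumK (λ i → ℤ.+ N ℤ.* (sign (π i * b) ℤ.* T G (π i)))
      ≡⟨ sumOver-cong (allFin N) (λ i → trans (*-left-commute (ℤ.+ N) (sign (π i * b)) (T G (π i)))
           (trans (cong (sign (π i * b) ℤ.*_) (T-on-K G (π i) (π∈K i))) (*-left-commute (sign (π i * b)) (ℤ.+ (2 ℕ.^ m)) _))) ⟩
    sumK (λ i → ℤ.+ (2 ℕ.^ m) ℤ.* (sign (π i * b) ℤ.* sumK (λ j → G j ℤ.* sign (π i * π j))))
      ≡⟨ sumOver-*ˡ (allFin N) (ℤ.+ (2 ℕ.^ m)) _ ⟩
    ℤ.+ (2 ℕ.^ m) ℤ.* sumK (λ i → sign (π i * b) ℤ.* sumK (λ j → G j ℤ.* sign (π i * π j)))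
      ≡⟨ cong (ℤ.+ (2 ℕ.^ m) ℤ.*_) inner ⟩
    ℤ.+ (2 ℕ.^ m) ℤ.* (ℤ.+ N ℤ.* G (idx b))
      ≡⟨ *-left-commute (ℤ.+ (2 ℕ.^ m)) (ℤ.+ N) (G (idx b)) ⟩
    ℤ.+ N ℤ.* (ℤ.+ (2 ℕ.^ m) ℤ.* G (idx b)) ∎)
    where
    merge : ∀ i j → sign (π i * b) ℤ.* (G j ℤ.* sign (π i * π j)) ≡ G j ℤ.* sign ((tr b + π j) * π i)
    merge i j = trans (*-left-commute (sign (π i * b)) (G j) _) (cong (G j ℤ.*_) (begin
      sign (π i * b) ℤ.* sign (π i * π j)
        ≡⟨ cong (ℤ._* sign (π i * π j)) (sign-cong-Tr (sym (Tr-tr b (π∈K i)))) ⟩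
      sign (π i * tr b) ℤ.* sign (π i * π j)
        ≡⟨ sign-+ _ _ ⟨
      sign (π i * tr b + π i * π j)
        ≡⟨ cong sign (trans (sym (distribˡ (π i) (tr b) (π j))) (*-comm (π i) _)) ⟩
      sign ((tr b + π j) * π i) ∎))
    column : Fin N → ℤ
    column j = G j ℤ.* sumK (λ i → sign ((tr b + π j) * π i))
    column-≢ : ∀ j → ¬ j ≡ idx b → column j ≡ ℤ.0ℤ
    column-≢ j j≢ = trans (cong (G j ℤ.*_) (sumK-sign (K-+ (tr∈K b) (π∈K j))
      (λ e → j≢ (sym (idx-unique (x+y≡0⇒x≡y e)))))) (ℤₚ.*-zeroʳ (G j))
    column-≡ : column (idx b) ≡ ℤ.+ N ℤ.* G (idx b)
    column-≡ = trans (cong (G (idx b) ℤ.*_) (trans (sumOver-cong (allFin N) λ i → trans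
        (cong (λ t → sign (t * π i)) (trans (cong (tr b +_) (π-idx b)) (x+x≡0 (tr b))))
        (trans (cong sign (zeroˡ (π i))) sign-0)) (trans (sumK-const ℤ.1ℤ) (ℤₚ.*-identityʳ _))))
      (ℤₚ.*-comm (G (idx b)) (ℤ.+ N))
    inner : sumK (λ i → sign (π i * b) ℤ.* sumK (λ j → G j ℤ.* sign (π i * π j))) ≡ ℤ.+ N ℤ.* G (idx b)
    inner = begin
      sumK (λ i → sign (π i * b) ℤ.* sumK (λ j → G j ℤ.* sign (π i * π j)))
        ≡⟨ sumOver-cong (allFin N) (λ i → sym (sumOver-*ˡ (allFin N) (sign (π i * b)) _)) ⟩
      sumK (λ i → sumK λ j → sign (π i * b) ℤ.* (G j ℤ.* sign (π i * π j)))
        ≡⟨ sumOver-cong (allFin N) (λ i → sumOver-cong (allFin N) (merge i)) ⟩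
      sumK (λ i → sumK λ j → G j ℤ.* sign ((tr b + π j) * π i))
        ≡⟨ sumOver-swap (allFin N) (allFin N) _ ⟩
      sumK (λ j → sumK λ i → G j ℤ.* sign ((tr b + π j) * π i))
        ≡⟨ sumOver-cong (allFin N) (λ j → sumOver-*ˡ (allFin N) (G j) _) ⟩
      sumK column
        ≡⟨ sumOver-single Fin._≟_ (Uniqueₚ.allFin⁺ N) (∈-allFin (idx b)) column column-≢ ⟩
      column (idx b)
        ≡⟨ column-≡ ⟩
      ℤ.+ N ℤ.* G (idx b) ∎

  -- Summation along the curves of a permutation.

  module Curves (P Q : Carrier → Carrier) (PQ : ∀ x → P (Q x) ≡ x) (QP : ∀ x → Q (P x) ≡ x) (P0 : P 0# ≡ 0#)
      (f : Carrier → Carrier → Fin N) (f-0 : ∀ y → f 0# y ≡ f 0# 0#)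
      (f-P : ∀ x s → ¬ x ≡ 0# → f x (s * P x) ≡ idx s) where

    row : (Fin N → ℤ) → Carrier → Carrier → Carrier → ℤ
    row G u v x = sumC λ y → G (f x y) ℤ.* sign (u * x + v * y)

    row-≢0 : ∀ G u v x → ¬ x ≡ 0# → row G u v x ≡ sign (u * x) ℤ.* T G (v * P x)
    row-≢0 G u v x x≢0 = reindex (inverse (P x) (λ e → x≢0 (trans (sym (QP x)) (trans (cong Q (trans e (sym P0))) (QP 0#)))))
      where
      reindex : (∃ λ p → P x * p ≡ 1#) → row G u v x ≡ sign (u * x) ℤ.* T G (v * P x)
      reindex (p , Pxp) = begin
        row G u v x
          ≡⟨ sumOver-bijection unique complete (_* P x) (_* p)
               (λ y → trans (*-assoc y p (P x)) (trans (cong (y *_) (trans (*-comm p (P x)) Pxp)) (*-identityʳ y)))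
               (λ s → trans (*-assoc s (P x) p) (trans (cong (s *_) Pxp) (*-identityʳ s))) _ ⟨
        sumC (λ s → G (f x (s * P x)) ℤ.* sign (u * x + v * (s * P x)))
          ≡⟨ sumOver-cong elems (λ s → trans (cong₂ (λ i σ → G i ℤ.* σ) (f-P x s x≢0)
               (trans (cong (λ t → sign (u * x + t)) (trans (cong (v *_) (*-comm s (P x))) (sym (*-assoc v (P x) s))))
                 (sign-+ (u * x) (v * P x * s))))
               (*-left-commute (G (idx s)) (sign (u * x)) _)) ⟩
        sumC (λ s → sign (u * x) ℤ.* (G (idx s) ℤ.* sign (v * P x * s)))
          ≡⟨ sumOver-*ˡ elems (sign (u * x)) _ ⟩
        sign (u * x) ℤ.* T G (v * P x) ∎

    sign*T0 : ∀ G → sumK G ≡ ℤ.0ℤ → ∀ σ {w} → w ≡ 0# → σ ℤ.* T G w ≡ ℤ.0ℤ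
    sign*T0 G balanced σ refl = trans (cong (σ ℤ.*_) (T-0 G balanced)) (ℤₚ.*-zeroʳ σ)

    row-0 : ∀ G u v → ¬ v ≡ 0# → row G u v 0# ≡ ℤ.0ℤ
    row-0 G u v v≢0 = begin
      row G u v 0#
        ≡⟨ sumOver-cong elems (λ y → cong₂ (λ i t → G i ℤ.* sign t) (f-0 y)
             (trans (cong (_+ v * y) (zeroʳ u)) (+-identityˡ (v * y)))) ⟩
      sumC (λ y → G (f 0# 0#) ℤ.* sign (v * y)) ≡⟨ sumOver-*ˡ elems (G (f 0# 0#)) _ ⟩
      G (f 0# 0#) ℤ.* sumC (λ y → sign (v * y)) ≡⟨ cong (G (f 0# 0#) ℤ.*_) (sum-sign v≢0) ⟩
      G (f 0# 0#) ℤ.* ℤ.0ℤ                      ≡⟨ ℤₚ.*-zeroʳ (G (f 0# 0#)) ⟩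
      ℤ.0ℤ                                      ∎

    -- Only the line `x = 0#` contributes, and its `2^m` points share one value of `f` and sign 1;
    -- this determines `i₀`.
    correlation-v≡0 : ∀ G u → sumK G ≡ ℤ.0ℤ → correlation F f G u 0# ≡ ℤ.+ (2 ℕ.^ m) ℤ.* G (f 0# 0#)
    correlation-v≡0 G u balanced = begin
      sumC (row G u 0#)
        ≡⟨ sumOver-single _≟_ unique (complete 0#) _ (λ x x≢0 →
             trans (row-≢0 G u 0# x x≢0) (sign*T0 G balanced (sign (u * x)) (zeroˡ (P x)))) ⟩
      row G u 0# 0#
        ≡⟨ sumOver-cong elems (λ y → trans (cong₂ (λ i t → G i ℤ.* sign t) (f-0 y)
             (trans (cong₂ _+_ (zeroʳ u) (zeroˡ y)) (+-identityˡ 0#)))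
             (trans (cong (G (f 0# 0#) ℤ.*_) sign-0) (ℤₚ.*-identityʳ _))) ⟩
      sumC (λ _ → G (f 0# 0#))       ≡⟨ sumC-const _ ⟩
      ℤ.+ (2 ℕ.^ m) ℤ.* G (f 0# 0#)  ∎

    correlation-v≢0 : ∀ G u v v⁻¹ b → sumK G ≡ ℤ.0ℤ → ¬ v ≡ 0# → v * v⁻¹ ≡ 1# →
      (∀ w → K w → sign (u * Q (w * v⁻¹)) ≡ sign (w * b)) →
      correlation F f G u v ≡ ℤ.+ (2 ℕ.^ m) ℤ.* G (idx b)
    correlation-v≢0 G u v v⁻¹ b balanced v≢0 vv⁻¹ character = begin
      sumC (row G u v)
        ≡⟨ sumOver-cong elems row-all ⟩
      sumC (λ x → sign (u * x) ℤ.* T G (v * P x))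
        -- The new variable `w = v * P x` is the argument of `T`, which then confines it to `K`.
        ≡⟨ sumOver-bijection unique complete φ ψ φψ ψφ _ ⟨
      sumC (λ w → sign (u * φ w) ℤ.* T G (ψ (φ w)))
        ≡⟨ sumOver-cong elems (λ w → cong (λ t → sign (u * φ w) ℤ.* T G t) (ψφ w)) ⟩
      sumC (λ w → sign (u * φ w) ℤ.* T G w)
        ≡⟨ sumOver-support K? π π-injective unique (Uniqueₚ.allFin⁺ N)
             (λ {i} _ → complete (π i) , π∈K i)
             (λ {w} _ kw → let i , e = π-surjective w kw in i , ∈-allFin i , sym e)
             _ (λ w w∉K → trans (cong (sign (u * φ w) ℤ.*_) (T-off-K G w w∉K)) (ℤₚ.*-zeroʳ (sign (u * φ w)))) ⟩
      sumK (λ i → sign (u * φ (π i)) ℤ.* T G (π i))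
        ≡⟨ sumOver-cong (allFin N) (λ i → cong (ℤ._* T G (π i)) (character (π i) (π∈K i))) ⟩
      sumK (λ i → sign (π i * b) ℤ.* T G (π i))
        ≡⟨ concentrated-sum G b ⟩
      ℤ.+ (2 ℕ.^ m) ℤ.* G (idx b) ∎
      where
      φ ψ : Carrier → Carrier
      φ w = Q (w * v⁻¹)
      ψ x = v * P x
      φψ : ∀ x → φ (ψ x) ≡ x
      φψ x = trans (cong Q (trans (cong (_* v⁻¹) (*-comm v (P x))) (trans (*-assoc (P x) v v⁻¹)
        (trans (cong (P x *_) vv⁻¹) (*-identityʳ (P x)))))) (QP x)
      ψφ : ∀ w → ψ (φ w) ≡ w
      ψφ w = trans (cong (v *_) (trans (PQ (w * v⁻¹)) (*-comm w v⁻¹))) (trans (sym (*-assoc v v⁻¹ w))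
        (trans (cong (_* w) vv⁻¹) (*-identityˡ w)))
      -- The formula extends to `x = 0#` because both sides vanish there: the left since `v` is
      -- nonzero, the right since `G` is balanced.
      row-all : ∀ x → row G u v x ≡ sign (u * x) ℤ.* T G (v * P x)
      row-all x = by-cases (x ≟ 0#)
        where
        by-cases : Dec (x ≡ 0#) → row G u v x ≡ sign (u * x) ℤ.* T G (v * P x)
        by-cases (no x≢0)   = row-≢0 G u v x x≢0
        by-cases (yes refl) = trans (row-0 G u v v≢0)
          (sym (sign*T0 G balanced (sign (u * 0#)) (trans (cong (v *_) P0) (zeroʳ v))))

    concentrated : (∀ u c → ∃ λ b → ∀ w → K w → sign (u * Q (w * c)) ≡ sign (w * b)) → Concentrated F f
    concentrated characters u v with v ≟ 0#
    ... | yes refl = f 0# 0# , λ G balanced → correlation-v≡0 G u balanced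
    ... | no v≢0 with inverse v v≢0
    ...   | v⁻¹ , vv⁻¹ with characters u v⁻¹
    ...     | b , character = idx b , λ G balanced → correlation-v≢0 G u v v⁻¹ b balanced v≢0 vv⁻¹ character

  -- The two power maps and their characters on the subfield.

  sign-square : ∀ z → sign (z ^ 2) ≡ sign z
  sign-square z = sign-cong-Tr (Tr-square z)

  n : ℕ
  n = 2 ℕ.^ k ℕ.+ 1

  K-^n : ∀ {w} → K w → w ^ n ≡ w ^ 2
  K-^n {w} kw = trans (^-+ w (2 ℕ.^ k) 1) (cong (_* (w ^ 1)) kw)

  module _ (d : ℕ) (inverse-mod : (ℤ.+ (2 ℕ.^ m ℕ.∸ 1)) ∣ℤ
      (((ℤ.+ (2 ℕ.^ m) ℤ.- ℤ.+ (2 ℕ.^ k)) ℤ.- ℤ.+ 2) ℤ.* ℤ.+ d ℤ.- ℤ.+ 1)) where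

    exponents-agree : ∃₂ λ a b → (2 ℕ.^ m ℕ.∸ 2) ℕ.* d ℕ.* n ℕ.+ a ℕ.* length units ≡ 1 ℕ.+ b ℕ.* length units
    exponents-agree = agree (2 ℕ.^ m) (ℕₚ.^-monoʳ-≤ 2 degree≥1) size-units inverse-mod
      where
      -- `2^m` becomes a variable `t`, so that it can be matched as `suc (suc p)`, where `suc p` is
      -- the order of the group of units.
      agree : ∀ t → 2 ℕ.≤ t → t ≡ suc (length units) →
        (ℤ.+ (t ℕ.∸ 1)) ∣ℤ (((ℤ.+ t ℤ.- ℤ.+ (2 ℕ.^ k)) ℤ.- ℤ.+ 2) ℤ.* ℤ.+ d ℤ.- ℤ.+ 1) →
        ∃₂ λ a b → (t ℕ.∸ 2) ℕ.* d ℕ.* n ℕ.+ a ℕ.* length units ≡ 1 ℕ.+ b ℕ.* length units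
      agree (suc (suc p)) _ e div = subst (λ M → ∃₂ λ a b → p ℕ.* d ℕ.* n ℕ.+ a ℕ.* M ≡ 1 ℕ.+ b ℕ.* M)
        (ℕₚ.suc-injective e) (inverse-exponent p (2 ℕ.^ k) d div)
      agree (suc zero) (ℕ.s≤s ()) _ _

    negPow-^n : ∀ {y} → ¬ y ≡ 0# → negPow y d ^ n ≡ y
    negPow-^n {y} y≢0 with exponents-agree
    ... | a , b , e = begin
      negPow y d ^ n                               ≡⟨ ^-* y ((2 ℕ.^ m ℕ.∸ 2) ℕ.* d) n ⟨
      y ^ X                                        ≡⟨ *-identityʳ _ ⟨
      (y ^ X) * 1#                                 ≡⟨ cong (y ^ X *_) (order a) ⟨
      (y ^ X) * (y ^ (a ℕ.* length units))         ≡⟨ ^-+ y X _ ⟨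
      y ^ (X ℕ.+ a ℕ.* length units)               ≡⟨ cong (y ^_) e ⟩
      y * (y ^ (b ℕ.* length units))               ≡⟨ cong (y *_) (order b) ⟩
      y * 1#                                       ≡⟨ *-identityʳ y ⟩
      y                                            ∎
      where
      X : ℕ
      X = (2 ℕ.^ m ℕ.∸ 2) ℕ.* d ℕ.* n
      order : ∀ a → y ^ (a ℕ.* length units) ≡ 1#
      order a = trans (^-* y a (length units)) (unit-order (^-≢0 a y≢0))

    -- When the exponent `(2^m - 2) * d` is 0, as for `m = 1`, `negPow 0# d` is `1#`. Fixing the
    -- value at `0#` makes `θ` a permutation.
    θ : Carrier → Carrier
    θ y = if does (y ≟ 0#) then 0# else negPow y d

    θ-0 : θ 0# ≡ 0#
    θ-0 = cong (λ b → if b then 0# else negPow 0# d) (dec-true (0# ≟ 0#) refl)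

    θ-≢0 : ∀ {y} → ¬ y ≡ 0# → θ y ≡ negPow y d
    θ-≢0 {y} y≢0 = cong (λ b → if b then 0# else negPow y d) (dec-false (y ≟ 0#) y≢0)

    0^n : 0# ^ n ≡ 0#
    0^n = 0^ (ℕₚ.m≤n+m 1 (2 ℕ.^ k))

    θ-^n : ∀ y → θ y ^ n ≡ y
    θ-^n y with y ≟ 0#
    ... | yes refl = 0^n
    ... | no y≢0   = negPow-^n y≢0

    ^n-θ : ∀ x → θ (x ^ n) ≡ x
    ^n-θ x with x ≟ 0#
    ... | yes refl = trans (cong θ 0^n) θ-0
    ... | no x≢0   = trans (θ-≢0 (^-≢0 n x≢0)) (trans (^-comm x n ((2 ℕ.^ m ℕ.∸ 2) ℕ.* d)) (negPow-^n x≢0))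

    -- `θ` turns the factor `w` in `K` into its square root. Squaring the whole argument preserves
    -- its trace and makes it linear in `w`, with the square of `u * θ c` as coefficient.
    characters-θ : ∀ u c → ∃ λ b → ∀ w → K w → sign (u * θ (w * c)) ≡ sign (w * b)
    characters-θ u c = (u * θ c) ^ 2 , λ w kw → begin
      sign (u * θ (w * c))            ≡⟨ cong (λ t → sign (u * t)) (θ-K* w kw) ⟩
      sign (u * (sqrt w * θ c))       ≡⟨ sign-square _ ⟨
      sign ((u * (sqrt w * θ c)) ^ 2) ≡⟨ cong (λ t → sign (t ^ 2)) (left-commute-* u (sqrt w) (θ c)) ⟩
      sign ((sqrt w * (u * θ c)) ^ 2) ≡⟨ cong sign (*-^ (sqrt w) (u * θ c) 2) ⟩
      sign (sqrt w ^ 2 * (u * θ c) ^ 2) ≡⟨ cong (λ t → sign (t * (u * θ c) ^ 2)) (sqrt-^2 w) ⟩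
      sign (w * (u * θ c) ^ 2)        ∎
      where
      left-commute-* : ∀ a b c → a * (b * c) ≡ b * (a * c)
      left-commute-* a b c = trans (sym (*-assoc a b c)) (trans (cong (_* c) (*-comm a b)) (*-assoc b a c))
      θ-K* : ∀ w → K w → θ (w * c) ≡ sqrt w * θ c
      θ-K* w kw = trans (cong θ (sym (trans (*-^ (sqrt w) (θ c) n)
          (cong₂ _*_ (trans (K-^n (K-^ (2 ℕ.^ (m ℕ.∸ 1)) kw)) (sqrt-^2 w)) (θ-^n c)))))
        (^n-θ (sqrt w * θ c))

    -- Here `w` appears squared, so the coefficient is a square root instead.
    characters-^n : ∀ u c → ∃ λ b → ∀ w → K w → sign (u * (w * c) ^ n) ≡ sign (w * b)
    characters-^n u c = sqrt (u * (c ^ n)) , λ w kw → begin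
      sign (u * (w * c) ^ n)                  ≡⟨ cong (λ t → sign (u * t)) (*-^ w c n) ⟩
      sign (u * (w ^ n * c ^ n))              ≡⟨ cong (λ t → sign (u * (t * c ^ n))) (K-^n kw) ⟩
      sign (u * (w ^ 2 * c ^ n))              ≡⟨ cong sign (trans (sym (*-assoc u (w ^ 2) (c ^ n)))
                                                  (trans (cong (_* c ^ n) (*-comm u (w ^ 2))) (*-assoc (w ^ 2) u (c ^ n)))) ⟩
      sign (w ^ 2 * (u * c ^ n))              ≡⟨ cong (λ t → sign (w ^ 2 * t)) (sqrt-^2 (u * c ^ n)) ⟨
      sign (w ^ 2 * sqrt (u * c ^ n) ^ 2)     ≡⟨ cong sign (*-^ w (sqrt (u * c ^ n)) 2) ⟨
      sign ((w * sqrt (u * c ^ n)) ^ 2)       ≡⟨ sign-square _ ⟩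
      sign (w * sqrt (u * c ^ n))             ∎

    bent-A : (f : Carrier → Carrier → Fin N) → (∀ y → toℕ (f 0# y) ≡ 0) →
      (∀ i x y → InA k q (π i) x y → f x y ≡ i) → IsBent F k f
    bent-A f f-0 f-A = concentrated⇒bent F k f (Curves.concentrated (_^ n) θ θ-^n ^n-θ 0^n f
      (λ y → Finₚ.toℕ-injective (trans (f-0 y) (sym (f-0 0#))))
      (λ x s x≢0 → f-A (idx s) x _ (x≢0 , s , sym (π-idx s) , refl))
      characters-θ)

    -- With the coordinates exchanged, the curves are `x = s * θ y`, so the two permutations change
    -- places.
    bent-B : (f : Carrier → Carrier → Fin N) → (∀ x → toℕ (f x 0#) ≡ 0) →
      (∀ i x y → InB k q d (π i) x y → f x y ≡ i) → IsBent F k f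
    bent-B f f-0 f-B = concentrated⇒bent F k f (Concentrated-flip F (flip f)
      (Curves.concentrated θ (_^ n) ^n-θ θ-^n θ-0 (flip f)
        (λ x → Finₚ.toℕ-injective (trans (f-0 x) (sym (f-0 0#))))
        (λ y s y≢0 → f-B (idx s) _ y (y≢0 , s , sym (π-idx s) ,
          trans (*-comm s (θ y)) (cong (_* s) (θ-≢0 y≢0))))
        characters-^n))

open import Data.Nat using (_^_; _∸_; _+_)
open import Data.Integer using (+_; _-_; _*_)

theorem12 : (m k : ℕ) → (k∣m : k ∣ m) → gcd (2 ^ m ∸ 1) (2 ^ k + 1) ≡ 1 →
    (d : ℕ) → (+ (2 ^ m ∸ 1)) ∣ℤ (((+ (2 ^ m) - + (2 ^ k)) - + 2) * + d - + 1) →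
    (F : GF2^ m) →
    (π : Fin (2 ^ k) → GF2^.Carrier F) →
    (∀ i → GF2^.InSubfield F k (π i)) → Injective _≡_ _≡_ π →
    (∀ γ → GF2^.InSubfield F k γ → ∃ λ i → π i ≡ γ) →
    (fA fB : GF2^.Carrier F → GF2^.Carrier F → Fin (2 ^ k)) →
    (∀ y → toℕ (fA (GF2^.0# F) y) ≡ 0) →
    (∀ i x y → GF2^.InA F k (_∣_.quotient k∣m) (π i) x y → fA x y ≡ i) →
    (∀ x → toℕ (fB x (GF2^.0# F)) ≡ 0) →
    (∀ i x y → GF2^.InB F k (_∣_.quotient k∣m) d (π i) x y → fB x y ≡ i) →
    IsBent F k fA × IsBent F k fB
theorem12 m k (divides q m≡qk) coprime d inverse-mod F π π∈K π-injective π-surjective fA fB fA-0 fA-A fB-0 fB-B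
  with coprime⇒odd q k (subst (λ n → gcd (2 ^ n ∸ 1) (2 ^ k + 1) ≡ 1) m≡qk coprime)
... | r , refl = bent-A d inverse-mod fA fA-0 fA-A , bent-B d inverse-mod fB fB-0 fB-B
  where open Concentration F k r m≡qk π π∈K π-injective π-surjective
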